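{- For all $n\ge1$ and $1\le k\le n$, the number of permutations of $[n]$ with $k$ cycles that cyclically avoid 1--3--2 equals the number of permutations of $[n]$ with $k$ cycles that cyclically avoid 1--2--3, equals the number of Dyck paths of semilength $n$ with $k$ peaks, equals the number of 1--3--2-avoiding permutations of $[n]$ (one-line notation) with $k-1$ descents, and equals the Narayana number \[\frac{1}{k}\binom{n-1}{k-1}\binom{n}{k-1}.\]
   Context: The standard cycle form writes each cycle starting with its smallest element, cycles listed in decreasing order of smallest elements; $\Psi(\pi)$ is the word obtained by deleting the parentheses. $\pi$ cyclically avoids the classical pattern $\sigma$ (here 1--3--2 or 1--2--3) if the word $\Psi(\pi)$ has no indices $i<j<k$ with $\Psi(\pi)_i\Psi(\pi)_j\Psi(\pi)_k$ order-isomorphic to $\sigma$. A Dyck path of semilength $n$ is a lattice path from $(0,0)$ to $(2n,0)$ with steps $(1,1)$ and $(1,-1)$ never going below the $x$-axis; a peak is an up step immediately followed by a down step. A descent of $\pi$ is an index $i$ with $\pi(i)>\pi(i+1)$. -}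

module Defs where

open import Data.Bool using (Bool; true; false; _∧_; _∨_; not; if_then_else_)
open import Data.Nat using (ℕ; zero; suc; _+_; _*_; _∸_; _≡ᵇ_; _<ᵇ_; _≤ᵇ_)
open import Data.Nat.DivMod using (_/_)
open import Data.Nat.Combinatorics using (_C_)
open import Data.Fin using (Fin; toℕ)
open import Data.List using (List; []; _∷_; [_]; map; concatMap; length; filterᵇ; reverse; allFin)
open import Data.Vec using (Vec; lookup; toList) renaming ([] to []ᵥ; _∷_ to _∷ᵥ_)

allVecs : {X : Set} → List X → (n : ℕ) → List (Vec X n)
allVecs xs zero    = [ []ᵥ ]
allVecs xs (suc n) = concatMap (λ x → map (x ∷ᵥ_) (allVecs xs n)) xs

anyᵇ : {X : Set} → (X → Bool) → List X → Bool
anyᵇ p []       = false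
anyᵇ p (x ∷ xs) = p x ∨ anyᵇ p xs

allᵇ : {X : Set} → (X → Bool) → List X → Bool
allᵇ p []       = true
allᵇ p (x ∷ xs) = p x ∧ allᵇ p xs

count : {X : Set} → (X → Bool) → List X → ℕ
count p xs = length (filterᵇ p xs)

-- Permutations of [n] in one-line notation: vectors (π(1),…,π(n)) with
-- distinct entries in Fin n (value j : Fin n stands for j+1 ∈ [n]).

distinct : List ℕ → Bool
distinct []       = true
distinct (x ∷ xs) = not (anyᵇ (λ y → x ≡ᵇ y) xs) ∧ distinct xs

isPerm : {n : ℕ} → Vec (Fin n) n → Bool
isPerm v = distinct (map toℕ (toList v))

perms : (n : ℕ) → List (Vec (Fin n) n)
perms n = filterᵇ isPerm (allVecs (allFin n) n)

-- the cycle of π through i, written starting at i: i, π(i), π²(i), …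
-- (fuel n suffices: every cycle has length ≤ n)
cycleOf : {n : ℕ} → Vec (Fin n) n → Fin n → List (Fin n)
cycleOf {n} π i = i ∷ go n (lookup π i)
  where
  go : ℕ → Fin _ → List (Fin _)
  go zero    x = []
  go (suc f) x = if toℕ x ≡ᵇ toℕ i then [] else x ∷ go f (lookup π x)

isCycleMin : {n : ℕ} → Vec (Fin n) n → Fin n → Bool
isCycleMin π i = allᵇ (λ x → toℕ i ≤ᵇ toℕ x) (cycleOf π i)

cycleMins : {n : ℕ} → Vec (Fin n) n → List (Fin n)
cycleMins {n} π = filterᵇ (isCycleMin π) (reverse (allFin n))

numCycles : {n : ℕ} → Vec (Fin n) n → ℕ
numCycles π = length (cycleMins π)

-- Ψ(π): the standard cycle form (each cycle starting with its smallest
-- element, cycles in decreasing order of smallest elements) with the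
-- parentheses erased
Ψ : {n : ℕ} → Vec (Fin n) n → List ℕ
Ψ π = map toℕ (concatMap (cycleOf π) (cycleMins π))

anyPair : (ℕ → ℕ → Bool) → List ℕ → Bool
anyPair r []       = false
anyPair r (b ∷ w)  = anyᵇ (r b) w ∨ anyPair r w

occurs : (ℕ → ℕ → ℕ → Bool) → List ℕ → Bool
occurs r []      = false
occurs r (a ∷ w) = anyPair (r a) w ∨ occurs r w

pat132 : ℕ → ℕ → ℕ → Bool
pat132 a b c = (a <ᵇ c) ∧ (c <ᵇ b)

pat123 : ℕ → ℕ → ℕ → Bool
pat123 a b c = (a <ᵇ b) ∧ (b <ᵇ c)

avoids : (ℕ → ℕ → ℕ → Bool) → List ℕ → Bool
avoids r w = not (occurs r w)

cycAvoids : {n : ℕ} → (ℕ → ℕ → ℕ → Bool) → Vec (Fin n) n → Bool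
cycAvoids r π = avoids r (Ψ π)

avoidsOneLine : {n : ℕ} → (ℕ → ℕ → ℕ → Bool) → Vec (Fin n) n → Bool
avoidsOneLine r π = avoids r (map toℕ (toList π))

desList : List ℕ → ℕ
desList (a ∷ b ∷ w) = (if b <ᵇ a then 1 else 0) + desList (b ∷ w)
desList _           = 0

descents : {n : ℕ} → Vec (Fin n) n → ℕ
descents π = desList (map toℕ (toList π))

-- Dyck paths: words over {U = true, D = false}

dyckFrom : ℕ → List Bool → Bool
dyckFrom h []           = h ≡ᵇ 0
dyckFrom h (true ∷ w)   = dyckFrom (suc h) w
dyckFrom zero (false ∷ w)    = false
dyckFrom (suc h) (false ∷ w) = dyckFrom h w

isDyck : List Bool → Bool
isDyck = dyckFrom 0

peaks : List Bool → ℕ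
peaks (true ∷ false ∷ w) = suc (peaks (false ∷ w))
peaks (_ ∷ w)            = peaks w
peaks []                 = 0

dyckPaths : ℕ → List (List Bool)
dyckPaths n = filterᵇ isDyck (map toList (allVecs (true ∷ false ∷ []) (2 * n)))

narayana : ℕ → ℕ → ℕ
narayana n zero    = 0
narayana n (suc j) = (((n ∸ 1) C j) * (n C j)) / suc j

{-# OPTIONS --safe #-}
module Submission where

-- Erasing the parentheses of the standard cycle form is a bijection on
-- permutations that turns the number of cycles into the number of
-- left-to-right minima. Read a word from left to right: if it avoids 132
-- (resp. 123), every letter that is not a left-to-right minimum is the smallest
-- (resp. largest) unused value above the current minimum. So the word is
-- determined by the values and positions of its minima, and recording a drop of
-- the minimum by d as U^d D and any other letter as D is a bijection to Dyck
-- paths sending minima to peaks. For a word avoiding 132, the same description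
-- shows that its descents are exactly the places where a new minimum appears.
-- Dyck paths are counted by a closed form for their suffixes from any height,
-- which satisfies the same recurrence.

open import Defs
open import Data.Bool using (Bool; true; false; T; _∧_; not; if_then_else_)
open import Data.Bool.Properties using (T?; T-∧; T-∨; T-≡; ∧-zeroʳ; ∧-comm; ∧-assoc)
open import Data.Empty using (⊥-elim)
open import Data.Fin using (Fin; toℕ; zero; suc)
open import Data.Fin.Properties using (toℕ-injective; toℕ<n)
open import Data.List using (List; []; _∷_; _++_; map; concat; concatMap; length; null; reverse; filterᵇ; tabulate; allFin; applyUpTo; applyDownFrom; upTo)
open import Data.Nat using (ℕ; zero; suc; _+_; _*_; _∸_; _≤_; _<_; _≮_; _≡ᵇ_; _<ᵇ_; _≤ᵇ_; z≤n; s≤s; z<s; s<s; s≤s⁻¹; s<s⁻¹; _<?_; _≟_)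
open import Data.List.Membership.DecPropositional _≟_ using (_∈?_)
open import Data.List.Membership.Propositional using (_∈_; _∉_; find; lose)
open import Data.List.Membership.Propositional.Properties using (∈-map⁺; ∈-map⁻; ∈-++⁺ˡ; ∈-++⁺ʳ; ∈-++⁻; ∈-filter⁺; ∈-filter⁻; ∈-allFin; ∈-concatMap⁺; ∈-applyUpTo⁺; ∈-applyUpTo⁻; ∈-applyDownFrom⁺; ∈-applyDownFrom⁻; ∈-upTo⁺; ∈-∃++)
open import Data.List.Properties using (length-++; length-map; length-tabulate; length-applyUpTo; length-applyDownFrom; length-upTo; length-++-sucʳ; map-tabulate; map-injective; ∷-injectiveˡ; ∷-injectiveʳ; concat-map; map-∘; unfold-reverse)
open import Data.List.Relation.Unary.All as All using (All; []; _∷_)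
import Data.List.Relation.Unary.All.Properties as Allₚ
open import Data.List.Relation.Unary.AllPairs as AllPairs using (AllPairs; []; _∷_)
import Data.List.Relation.Unary.AllPairs.Properties as AllPairsₚ
open import Data.List.Relation.Unary.Any using (here; there)
import Data.List.Relation.Unary.Any.Properties as Anyₚ
open import Data.List.Relation.Unary.Unique.Propositional using (Unique)
import Data.List.Relation.Unary.Unique.Propositional.Properties as Uniqueₚ
open import Data.List.Relation.Binary.Disjoint.Propositional using (Disjoint)
open import Data.Nat.Combinatorics using (_C_; nCk+nC[k+1]≡[n+1]C[k+1]; k>n⇒nCk≡0)
open import Data.Nat.DivMod using (_/_; m*n/n≡m)
open import Data.Nat.GeneralisedArithmetic using (iterate)
open import Data.Nat.Induction using (<-wellFounded)
open import Data.Nat.ListAction using (sum)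
open import Data.Nat.Properties
open import Data.Nat.Tactic.RingSolver using (solve-∀)
open import Data.Product using (∃-syntax; _×_; _,_; proj₁; proj₂)
open import Data.Sum using (_⊎_; inj₁; inj₂; [_,_]′)
open import Data.Unit using (⊤; tt)
open import Data.Vec as Vec using (Vec; lookup; toList; fromList) renaming ([] to []ᵥ; _∷_ to _∷ᵥ_)
import Data.Vec.Properties as Vecₚ
open import Function using (_∘_; id)
open import Function.Bundles using (Equivalence)
open import Induction.WellFounded using (Acc; acc)
open import Relation.Binary.Definitions using (tri<; tri≈; tri>)
open import Relation.Binary.PropositionalEquality using (_≡_; _≢_; refl; sym; trans; cong; cong₂; subst; subst₂; module ≡-Reasoning)
open import Relation.Nullary using (¬_; yes; no; contradiction)

-- No map from words to paths is built; only counts are compared. The order in which those values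
-- must be read does not enter, so one count serves both patterns. The pattern matters only for
-- showing that the greedy reading accepts exactly the avoiding permutations. That reading is
-- counted over all words, because it forces by itself that every value is used once. For `Ψ` no
-- inverse is constructed: injectivity and finiteness suffice. The Narayana number hides a division
-- and a subtraction. The closed form is therefore stated as an addition, proved by Pascal's rule,
-- and multiplied by the number of peaks before anything is divided.

T-ext : ∀ {a b} → (T a → T b) → (T b → T a) → a ≡ b
T-ext {true}  {true}  f g = refl
T-ext {true}  {false} f g = ⊥-elim (f tt)
T-ext {false} {true}  f g = ⊥-elim (g tt)
T-ext {false} {false} f g = refl

<⇒<ᵇ≡true : ∀ {m n} → m < n → (m <ᵇ n) ≡ true
<⇒<ᵇ≡true m<n = Equivalence.to T-≡ (<⇒<ᵇ m<n)

≮⇒<ᵇ≡false : ∀ {m n} → m ≮ n → (m <ᵇ n) ≡ false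
≮⇒<ᵇ≡false {m} {n} m≮n with m <ᵇ n in eq
... | true  = contradiction (<ᵇ⇒< m n (Equivalence.from T-≡ eq)) m≮n
... | false = refl

≡ᵇ-refl : ∀ m → (m ≡ᵇ m) ≡ true
≡ᵇ-refl m = Equivalence.to T-≡ (≡⇒≡ᵇ m m refl)

≢⇒≡ᵇ≡false : ∀ {m n} → m ≢ n → (m ≡ᵇ n) ≡ false
≢⇒≡ᵇ≡false {m} {n} m≢n with m ≡ᵇ n in eq
... | true  = contradiction (≡ᵇ⇒≡ m n (Equivalence.from T-≡ eq)) m≢n
... | false = refl

-- Counting

private
  variable
    X Y : Set

count-cong-∈ : ∀ {p q : X → Bool} xs → (∀ {x} → x ∈ xs → p x ≡ q x) → count p xs ≡ count q xs
count-cong-∈ []       e = refl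
count-cong-∈ {p = p} {q = q} (x ∷ xs) e with p x | q x | e (here refl)
... | true  | .true  | refl = cong suc (count-cong-∈ xs (e ∘ there))
... | false | .false | refl = count-cong-∈ xs (e ∘ there)

count-cong : ∀ {p q : X → Bool} xs → (∀ x → p x ≡ q x) → count p xs ≡ count q xs
count-cong xs e = count-cong-∈ xs (λ {x} _ → e x)

count-none : ∀ {p : X → Bool} xs → (∀ x → p x ≡ false) → count p xs ≡ 0
count-none []       e = refl
count-none {p = p} (x ∷ xs) e with p x | e x
... | .false | refl = count-none xs e

count-++ : ∀ (p : X → Bool) xs ys → count p (xs ++ ys) ≡ count p xs + count p ys
count-++ p []       ys = refl
count-++ p (x ∷ xs) ys with p x
... | true  = cong suc (count-++ p xs ys)
... | false = count-++ p xs ys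

count-map : ∀ (p : X → Bool) (f : Y → X) ys → count p (map f ys) ≡ count (p ∘ f) ys
count-map p f []       = refl
count-map p f (y ∷ ys) with p (f y)
... | true  = cong suc (count-map p f ys)
... | false = count-map p f ys

count-filter : ∀ (p q : X → Bool) xs → count p (filterᵇ q xs) ≡ count (λ x → q x ∧ p x) xs
count-filter p q []       = refl
count-filter p q (x ∷ xs) with q x
... | false = count-filter p q xs
... | true  with p x
...   | true  = cong suc (count-filter p q xs)
...   | false = count-filter p q xs

count-complement : ∀ (p : X → Bool) xs → count p xs + count (not ∘ p) xs ≡ length xs
count-complement p []       = refl
count-complement p (x ∷ xs) with p x
... | true  = cong suc (count-complement p xs)
... | false = trans (+-suc _ _) (cong suc (count-complement p xs))

count-allVecs-suc : ∀ {l} (p : Vec X (suc l) → Bool) xs →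
  count p (allVecs xs (suc l)) ≡ sum (map (λ x → count (p ∘ (x ∷ᵥ_)) (allVecs xs l)) xs)
count-allVecs-suc {l = l} p xs = go xs
  where
  go : ∀ ys → count p (concatMap (λ x → map (x ∷ᵥ_) (allVecs xs l)) ys)
            ≡ sum (map (λ x → count (p ∘ (x ∷ᵥ_)) (allVecs xs l)) ys)
  go []       = refl
  go (y ∷ ys) = trans (count-++ p (map (y ∷ᵥ_) (allVecs xs l)) _)
                      (cong₂ _+_ (count-map p (y ∷ᵥ_) (allVecs xs l)) (go ys))

-- Dyck paths

-- pathsFrom m h k counts the completions of a Dyck path at height h that
-- have m up steps and k peaks. pathsAfterUp m h k does so when the path is
-- at height suc h just after an up step, which may form one of the peaks.
pathsFrom    : ℕ → ℕ → ℕ → ℕ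
pathsAfterUp : ℕ → ℕ → ℕ → ℕ

pathsFrom zero    zero    zero    = 1
pathsFrom zero    zero    (suc k) = 0
pathsFrom zero    (suc h) k       = pathsFrom zero h k
pathsFrom (suc m) zero    k       = pathsAfterUp m zero k
pathsFrom (suc m) (suc h) k       = pathsAfterUp m (suc h) k + pathsFrom (suc m) h k

pathsAfterUp zero    h zero    = 0
pathsAfterUp zero    h (suc k) = pathsFrom zero h k
pathsAfterUp (suc m) h zero    = pathsAfterUp m (suc h) zero
pathsAfterUp (suc m) h (suc k) = pathsAfterUp m (suc h) (suc k) + pathsFrom (suc m) h k

-- The path must come down again, and the first down step closes a peak with the up step before it.
pathsAfterUp-no-peak : ∀ m h → pathsAfterUp m h 0 ≡ 0
pathsAfterUp-no-peak zero    h = refl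
pathsAfterUp-no-peak (suc m) h = pathsAfterUp-no-peak m (suc h)

private
  steps : List Bool
  steps = true ∷ false ∷ []

  count-steps-suc : ∀ {l} (p : Vec Bool (suc l) → Bool) → count p (allVecs steps (suc l))
    ≡ count (p ∘ (true ∷ᵥ_)) (allVecs steps l) + count (p ∘ (false ∷ᵥ_)) (allVecs steps l)
  count-steps-suc {l} p = trans (count-allVecs-suc p steps)
    (cong (count (p ∘ (true ∷ᵥ_)) (allVecs steps l) +_) (+-identityʳ _))

dyckFrom-short : ∀ {l h} (v : Vec Bool l) → l < h → dyckFrom h (toList v) ≡ false
dyckFrom-short {h = suc h} []ᵥ           _   = refl
dyckFrom-short {h = suc h} (true  ∷ᵥ v) l<h = dyckFrom-short v (m<n⇒m<1+n (<-trans (n<1+n _) l<h))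
dyckFrom-short {h = suc h} (false ∷ᵥ v) l<h = dyckFrom-short v (s<s⁻¹ l<h)

count-dyckFrom-short : ∀ {l h} (q : Vec Bool l → Bool) → l < h →
  count (λ v → dyckFrom h (toList v) ∧ q v) (allVecs steps l) ≡ 0
count-dyckFrom-short q l<h = count-none (allVecs steps _) (λ v → cong (_∧ q v) (dyckFrom-short v l<h))

-- A path from height `h` with `m` up steps has `m + h` down steps, so fixing the length `l` fixes
-- the number of up steps. The companion for `pathsAfterUp` keeps the preceding `true` in front of
-- the word, since `peaks` has to see it.
count-dyckFrom : ∀ l m h k → l ≡ m + (m + h) →
  count (λ v → dyckFrom h (toList v) ∧ (peaks (toList v) ≡ᵇ k)) (allVecs steps l) ≡ pathsFrom m h k
count-dyckFrom-afterUp : ∀ l m h k → l ≡ m + (m + suc h) →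
  count (λ v → dyckFrom (suc h) (toList v) ∧ (peaks (true ∷ toList v) ≡ᵇ k)) (allVecs steps l)
    ≡ pathsAfterUp m h k

count-dyckFrom zero zero zero zero    refl = refl
count-dyckFrom zero zero zero (suc k) refl = refl
count-dyckFrom (suc l) zero (suc h) k refl =
  trans (count-steps-suc {l} _)
        -- With no up step left, going up would leave fewer letters than the height to descend.
        (cong₂ _+_ (count-dyckFrom-short _ (m<n⇒m<1+n (n<1+n l)))
                   (count-dyckFrom l zero h k refl))
count-dyckFrom (suc l) (suc m) zero k refl =
  trans (count-steps-suc {l} _)
        (trans (cong₂ _+_ (count-dyckFrom-afterUp l m zero k (cong (m +_) (sym (+-suc m 0))))
                          (count-none (allVecs steps l) (λ v → refl)))
               (+-identityʳ _))
count-dyckFrom (suc l) (suc m) (suc h) k refl =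
  trans (count-steps-suc {l} _)
        (cong₂ _+_ (count-dyckFrom-afterUp l m (suc h) k (cong (m +_) (sym (+-suc m (suc h)))))
                   (count-dyckFrom l (suc m) h k (trans (+-suc m (m + suc h)) (cong (λ z → suc (m + z)) (+-suc m h)))))

count-dyckFrom-afterUp (suc l) zero h zero refl =
  trans (count-steps-suc {l} _)
        (cong₂ _+_ (count-dyckFrom-short _ (m<n⇒m<1+n (n<1+n l)))
                   (count-none (allVecs steps l) (λ v → ∧-zeroʳ _)))
count-dyckFrom-afterUp (suc l) zero h (suc k) refl =
  trans (count-steps-suc {l} _)
        (cong₂ _+_ (count-dyckFrom-short _ (m<n⇒m<1+n (n<1+n l)))
                   (count-dyckFrom l zero h k refl))
count-dyckFrom-afterUp (suc l) (suc m) h zero refl =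
  trans (count-steps-suc {l} _)
        (trans (cong₂ _+_ (count-dyckFrom-afterUp l m (suc h) zero (cong (m +_) (sym (+-suc m (suc h)))))
                          (count-none (allVecs steps l) (λ v → ∧-zeroʳ _)))
               (+-identityʳ _))
count-dyckFrom-afterUp (suc l) (suc m) h (suc k) refl =
  trans (count-steps-suc {l} _)
        (cong₂ _+_ (count-dyckFrom-afterUp l m (suc h) (suc k) (cong (m +_) (sym (+-suc m (suc h)))))
                   (count-dyckFrom l (suc m) h k (trans (+-suc m (m + suc h)) (cong (λ z → suc (m + z)) (+-suc m h)))))

count-dyckPaths : ∀ n k → count (λ p → peaks p ≡ᵇ k) (dyckPaths n) ≡ pathsFrom n 0 k
count-dyckPaths n k = begin
  count (λ p → peaks p ≡ᵇ k) (dyckPaths n)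
    ≡⟨ count-filter (λ p → peaks p ≡ᵇ k) isDyck (map toList (allVecs steps (2 * n))) ⟩
  count (λ p → isDyck p ∧ (peaks p ≡ᵇ k)) (map toList (allVecs steps (2 * n)))
    ≡⟨ count-map (λ p → isDyck p ∧ (peaks p ≡ᵇ k)) toList (allVecs steps (2 * n)) ⟩
  count (λ v → isDyck (toList v) ∧ (peaks (toList v) ≡ᵇ k)) (allVecs steps (2 * n))
    ≡⟨ count-dyckFrom (2 * n) n 0 k refl ⟩
  pathsFrom n 0 k ∎
  where open ≡-Reasoning

-- Narayana numbers

pathsFrom-no-up-no-peak : ∀ h → pathsFrom 0 h 0 ≡ 1
pathsFrom-no-up-no-peak zero    = refl
pathsFrom-no-up-no-peak (suc h) = pathsFrom-no-up-no-peak h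

pathsFrom-no-up : ∀ h k → pathsFrom 0 h (suc k) ≡ 0
pathsFrom-no-up zero    k = refl
pathsFrom-no-up (suc h) k = pathsFrom-no-up h k

private
  -- Pascal's rule in the second binomial factor of both products; `add-rows` is the same for the
  -- first factor.
  add-columns : ∀ q p b s u v u′ v′ → q + b * u ≡ s * v → p + b * u′ ≡ s * v′ →
                (q + p) + b * (u + u′) ≡ s * (v + v′)
  add-columns q p b s u v u′ v′ e e′ = begin
    (q + p) + b * (u + u′)       ≡⟨ regroup q p b u u′ ⟩
    (q + b * u) + (p + b * u′)   ≡⟨ cong₂ _+_ e e′ ⟩
    s * v + s * v′               ≡⟨ *-distribˡ-+ s v v′ ⟨
    s * (v + v′)                 ∎
    where
    open ≡-Reasoning
    regroup : ∀ q p b u u′ → (q + p) + b * (u + u′) ≡ (q + b * u) + (p + b * u′)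
    regroup = solve-∀

  add-rows : ∀ q p a b c s u v → q + b * u ≡ s * v → p + a * u ≡ c * v →
             (q + p) + (a + b) * u ≡ (c + s) * v
  add-rows q p a b c s u v e e′ = begin
    (q + p) + (a + b) * u        ≡⟨ regroup q p a b u ⟩
    (p + a * u) + (q + b * u)    ≡⟨ cong₂ _+_ e′ e ⟩
    c * v + s * v                ≡⟨ *-distribʳ-+ v c s ⟨
    (c + s) * v                  ∎
    where
    open ≡-Reasoning
    regroup : ∀ q p a b u → (q + p) + (a + b) * u ≡ (p + a * u) + (q + b * u)
    regroup = solve-∀

-- Both closed forms are reflection-principle differences of products of
-- binomial coefficients, with the subtrahend moved to the left-hand side.
pathsFrom-closed : ∀ m h k →
  pathsFrom (suc m) h k + (m C k) * ((2 + (m + h)) C k) ≡ (suc m C k) * ((1 + (m + h)) C k)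
pathsAfterUp-closed : ∀ m h k →
  pathsAfterUp m h (suc k) + (m C suc k) * ((1 + (m + h)) C k) ≡ (suc m C suc k) * ((m + h) C k)

pathsFrom-closed m zero    zero    = cong (_+ 1) (pathsAfterUp-no-peak m 0)
pathsFrom-closed m (suc h) zero    rewrite pathsAfterUp-no-peak m (suc h) = pathsFrom-closed m h zero
pathsFrom-closed m zero    (suc k)
  with ih ← pathsAfterUp-closed m zero k
  rewrite +-identityʳ m
        | sym (nCk+nC[k+1]≡[n+1]C[k+1] (suc m) k)
  = subst₂ (λ q v → q + (m C suc k) * ((suc m C k) + (suc m C suc k)) ≡ (suc m C suc k) * v)
      (+-identityʳ _) (nCk+nC[k+1]≡[n+1]C[k+1] m k)
      -- No down step is possible at height 0. The summand 0 fits because the closed form at height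
      -- -1 compares a product with itself in the other order: the boundary condition of the
      -- reflection principle.
      (add-columns (pathsAfterUp m 0 (suc k)) 0 (m C suc k) (suc m C suc k) (suc m C k) (m C k)
        (suc m C suc k) (m C suc k) ih (*-comm (m C suc k) (suc m C suc k)))
pathsFrom-closed m (suc h) (suc k)
  with ih ← pathsAfterUp-closed m (suc h) k
  rewrite +-suc m h
        | sym (nCk+nC[k+1]≡[n+1]C[k+1] (2 + (m + h)) k)
  = subst (λ v → pathsFrom (suc m) (suc h) (suc k) + (m C suc k) * (((2 + (m + h)) C k) + ((2 + (m + h)) C suc k)) ≡ (suc m C suc k) * v)
      (nCk+nC[k+1]≡[n+1]C[k+1] (1 + (m + h)) k)
      (add-columns (pathsAfterUp m (suc h) (suc k)) (pathsFrom (suc m) h (suc k)) (m C suc k) (suc m C suc k)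
        _ _ _ _ ih (pathsFrom-closed m h (suc k)))

pathsAfterUp-closed zero h zero = cong (_+ 0) (pathsFrom-no-up-no-peak h)
pathsAfterUp-closed zero h (suc k)
  rewrite pathsFrom-no-up h k
        | k>n⇒nCk≡0 {0} {2 + k} z<s
        | k>n⇒nCk≡0 {1} {2 + k} (s<s z<s) = refl
pathsAfterUp-closed (suc m) h k
  with ih ← pathsAfterUp-closed m (suc h) k
  rewrite +-suc m h
  = subst₂ (λ a c → pathsAfterUp (suc m) h (suc k) + a * ((2 + (m + h)) C k) ≡ c * ((1 + (m + h)) C k))
      (nCk+nC[k+1]≡[n+1]C[k+1] m k) (nCk+nC[k+1]≡[n+1]C[k+1] (suc m) k)
      (add-rows (pathsAfterUp m (suc h) (suc k)) (pathsFrom (suc m) h k) (m C k) (m C suc k)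
        (suc m C k) (suc m C suc k) _ _ ih (pathsFrom-closed m h k))

-- The rule (k+1) C(n,k+1) = (n-k) C(n,k), with the subtracted term moved to the left.
binomial-absorption : ∀ n k → suc k * (n C suc k) + k * (n C k) ≡ n * (n C k)
binomial-absorption zero zero = refl
binomial-absorption zero (suc k)
  rewrite k>n⇒nCk≡0 {0} {2 + k} z<s | k>n⇒nCk≡0 {0} {suc k} z<s
        | *-zeroʳ (suc (suc k)) = refl
binomial-absorption (suc n) zero
  rewrite sym (nCk+nC[k+1]≡[n+1]C[k+1] n 0) =
  trans (regroup (n C 1)) (trans (cong suc (binomial-absorption n 0)) refl)
  where
  regroup : ∀ x → 1 * (1 + x) + 0 * 1 ≡ 1 + (1 * x + 0 * 1)
  regroup = solve-∀
binomial-absorption (suc n) (suc k) = begin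
  (2 + k) * (suc n C (2 + k)) + (1 + k) * (suc n C (1 + k))
    ≡⟨ cong₂ (λ x y → (2 + k) * x + (1 + k) * y) (nCk+nC[k+1]≡[n+1]C[k+1] n (suc k)) (nCk+nC[k+1]≡[n+1]C[k+1] n k) ⟨
  (2 + k) * (b + c) + (1 + k) * (a + b)
    ≡⟨ regroup k a b c ⟩
  ((2 + k) * c + (1 + k) * b) + ((1 + k) * b + k * a) + (a + b)
    ≡⟨ cong₂ (λ x y → x + y + (a + b)) (binomial-absorption n (suc k)) (binomial-absorption n k) ⟩
  n * b + n * a + (a + b)
    ≡⟨ regroup′ n a b ⟩
  suc n * (a + b)
    ≡⟨ cong (suc n *_) (nCk+nC[k+1]≡[n+1]C[k+1] n k) ⟩
  suc n * (suc n C suc k) ∎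
  where
  open ≡-Reasoning
  a = n C k
  b = n C suc k
  c = n C (2 + k)
  regroup : ∀ k a b c → (2 + k) * (b + c) + (1 + k) * (a + b)
    ≡ ((2 + k) * c + (1 + k) * b) + ((1 + k) * b + k * a) + (a + b)
  regroup = solve-∀
  regroup′ : ∀ n a b → n * b + n * a + (a + b) ≡ suc n * (a + b)
  regroup′ = solve-∀

-- Multiplying the closed form at height 0 by `suc j` and absorbing once in row `m` and once in row
-- `suc m` leaves `m * x * y` against `suc m * y * x`, whose difference is `x * y`. This makes the
-- division in `narayana` exact.
pathsFrom-*-peaks : ∀ m j → pathsFrom (suc m) 0 (suc j) * suc j ≡ (m C j) * (suc m C j)
pathsFrom-*-peaks m j = +-cancelʳ-≡ (m * x * y) (p * suc j) (x * y) (begin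
  p * suc j + m * x * y
    ≡⟨ cong (λ z → p * suc j + z * y) (binomial-absorption m j) ⟨
  p * suc j + (suc j * x′ + j * x) * y
    ≡⟨ regroup p j x x′ y ⟩
  suc j * (p + x′ * y) + j * x * y
    ≡⟨ cong (λ z → suc j * z + j * x * y) closed ⟩
  suc j * (y′ * x) + j * x * y
    ≡⟨ regroup′ j x y y′ ⟩
  (suc j * y′ + j * y) * x
    ≡⟨ cong (_* x) (binomial-absorption (suc m) j) ⟩
  suc m * y * x
    ≡⟨ regroup″ m x y ⟩
  x * y + m * x * y ∎)
  where
  open ≡-Reasoning
  p = pathsFrom (suc m) 0 (suc j)
  x = m C j
  x′ = m C suc j
  y = suc m C j
  y′ = suc m C suc j
  closed : p + x′ * y ≡ y′ * x
  closed = subst (λ z → p + x′ * (suc z C j) ≡ y′ * (z C j)) (+-identityʳ m) (pathsAfterUp-closed m 0 j)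
  regroup : ∀ p j x x′ y → p * suc j + (suc j * x′ + j * x) * y ≡ suc j * (p + x′ * y) + j * x * y
  regroup = solve-∀
  regroup′ : ∀ j x y y′ → suc j * (y′ * x) + j * x * y ≡ (suc j * y′ + j * y) * x
  regroup′ = solve-∀
  regroup″ : ∀ m x y → suc m * y * x ≡ x * y + m * x * y
  regroup″ = solve-∀

pathsFrom≡narayana : ∀ m j → pathsFrom (suc m) 0 (suc j) ≡ narayana (suc m) (suc j)
pathsFrom≡narayana m j =
  trans (sym (m*n/n≡m (pathsFrom (suc m) 0 (suc j)) (suc j)))
        (cong (_/ suc j) (pathsFrom-*-peaks m j))

-- Words generated greedily

-- Splits off the largest index, as `pathsAfterUp` splits off the immediate down step: the largest
-- new minimum is the smallest drop.
sumBelow : ℕ → (ℕ → ℕ) → ℕ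
sumBelow zero    g = 0
sumBelow (suc n) g = sumBelow n g + g n

sumBelow-cong : ∀ n {g h} → (∀ {x} → x < n → g x ≡ h x) → sumBelow n g ≡ sumBelow n h
sumBelow-cong zero    e = refl
sumBelow-cong (suc n) e = cong₂ _+_ (sumBelow-cong n (e ∘ m<n⇒m<1+n)) (e (n<1+n n))

sumBelow-zero : ∀ n → sumBelow n (λ _ → 0) ≡ 0
sumBelow-zero zero    = refl
sumBelow-zero (suc n) = trans (+-identityʳ _) (sumBelow-zero n)

sumBelow-front : ∀ n g → sumBelow (suc n) g ≡ g 0 + sumBelow n (g ∘ suc)
sumBelow-front zero    g = sym (+-identityʳ (g 0))
sumBelow-front (suc n) g = trans (cong (_+ g (suc n)) (sumBelow-front n g)) (+-assoc (g 0) _ _)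

sum-allFin : ∀ n (g : ℕ → ℕ) → sum (map (g ∘ toℕ) (allFin n)) ≡ sumBelow n g
sum-allFin n g = trans (cong sum (map-tabulate {n = n} id (g ∘ toℕ))) (sum-tabulate n g)
  where
  sum-tabulate : ∀ n (g : ℕ → ℕ) → sum (tabulate {n = n} (g ∘ toℕ)) ≡ sumBelow n g
  sum-tabulate zero    g = refl
  sum-tabulate (suc n) g = trans (cong (g 0 +_) (sum-tabulate n (g ∘ suc))) (sym (sumBelow-front n g))

sumBelow-extend : ∀ {m} n {g} → m ≤ n → (∀ {x} → m ≤ x → x < n → g x ≡ 0) → sumBelow n g ≡ sumBelow m g
sumBelow-extend zero    z≤n g≡0 = refl
sumBelow-extend {m} (suc n) m≤1+n g≡0 with m≤n⇒m<n∨m≡n m≤1+n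
... | inj₂ refl  = refl
... | inj₁ m<1+n = trans
  (cong₂ _+_ (sumBelow-extend n (s≤s⁻¹ m<1+n) (λ m≤x x<n → g≡0 m≤x (m<n⇒m<1+n x<n))) (g≡0 (s≤s⁻¹ m<1+n) (n<1+n n)))
  (+-identityʳ _)

sumBelow-extend-one : ∀ {m a} n {g} → m ≤ a → a < n → (∀ {x} → m ≤ x → x ≢ a → g x ≡ 0) →
                      sumBelow n g ≡ sumBelow m g + g a
sumBelow-extend-one {m} {a} (suc n) {g} m≤a a<1+n g≡0 with m≤n⇒m<n∨m≡n (s≤s⁻¹ a<1+n)
... | inj₁ a<n  = trans (cong₂ _+_ (sumBelow-extend-one n m≤a a<n g≡0) (g≡0 (≤-trans m≤a (<⇒≤ a<n)) (>⇒≢ a<n)))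
                        (+-identityʳ _)
... | inj₂ refl = cong (_+ g a) (sumBelow-extend a m≤a (λ m≤x x<a → g≡0 m≤x (<⇒≢ x<a)))

-- Completions after the new minimum `x` with `l` letters to go: `x` of them are values below `x`,
-- and the other `l ∸ x` lie above it and give the height. The minimum itself uses up one of the `k`
-- peaks.
newMinTerm : ℕ → ℕ → ℕ → ℕ
newMinTerm l zero    x = 0
newMinTerm l (suc k) x = pathsFrom x (l ∸ x) k

-- Splits a path according to the number of up steps before its first down step.
pathsAfterUp-sum : ∀ m h k → pathsAfterUp m h k ≡ sumBelow (suc m) (newMinTerm (h + m) k)
pathsAfterUp-sum m h zero = trans (pathsAfterUp-no-peak m h) (sym (sumBelow-zero (suc m)))
pathsAfterUp-sum zero h (suc k) = cong (λ z → pathsFrom 0 z k) (sym (+-identityʳ h))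
pathsAfterUp-sum (suc m) h (suc k) =
  cong₂ _+_ (trans (pathsAfterUp-sum m (suc h) (suc k))
                   (sumBelow-cong (suc m) (λ {x} _ → cong (λ z → pathsFrom x (z ∸ x) k) (sym (+-suc h m)))))
            (cong (λ z → pathsFrom (suc m) z k) (sym (m+n∸n≡m h (suc m))))

pathsFrom-zero-sum : ∀ m k → pathsFrom (suc m) 0 k ≡ sumBelow (suc m) (newMinTerm m k)
pathsFrom-zero-sum m k = pathsAfterUp-sum m 0 k

pathsFrom-suc-sum : ∀ m h k → pathsFrom m (suc h) k ≡ sumBelow m (newMinTerm (h + m) k) + pathsFrom m h k
pathsFrom-suc-sum zero    h k = refl
pathsFrom-suc-sum (suc m) h k = cong (_+ pathsFrom (suc m) h k)
  (trans (pathsAfterUp-sum m (suc h) k) (cong (λ z → sumBelow (suc m) (newMinTerm z k)) (sym (+-suc h m))))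

-- Started with a bound above all letters, so that the first letter counts.
lrMinima : ℕ → List ℕ → ℕ
lrMinima m []      = 0
lrMinima m (x ∷ w) = if x <ᵇ m then suc (lrMinima x w) else lrMinima m w

word : ∀ {n l} → Vec (Fin n) l → List ℕ
word v = map toℕ (toList v)

-- greedy push m A w reads w while keeping the current left-to-right minimum
-- m and the list A of unused values above m. A letter below m becomes the
-- new minimum, and push inserts into A the values it skips; any other letter
-- must be the head of A.
greedy : (ℕ → ℕ → List ℕ → List ℕ) → ℕ → List ℕ → List ℕ → Bool
greedy push m A       []      = (m ≡ᵇ 0) ∧ null A
greedy push m []      (x ∷ w) = (x <ᵇ m) ∧ greedy push x (push x m []) w
greedy push m (a ∷ A) (x ∷ w) =
  if x <ᵇ m then greedy push x (push x m (a ∷ A)) w else (x ≡ᵇ a) ∧ greedy push m A w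

record IsPush (push : ℕ → ℕ → List ℕ → List ℕ) : Set where
  field
    length-push : ∀ {x m} A → x < m → length (push x m A) + suc x ≡ m + length A
    ∈-push⁺ˡ : ∀ {x m y} A → x < y → y < m → y ∈ push x m A
    ∈-push⁺ʳ : ∀ {x m y} A → y ∈ A → y ∈ push x m A
    ∈-push⁻ : ∀ {x m y} A → y ∈ push x m A → (x < y × y < m) ⊎ y ∈ A

  pushed>x : ∀ {x m A} → x < m → All (m <_) A → All (x <_) (push x m A)
  pushed>x {A = A} x<m A>m = All.tabulate λ y∈ →
    [ proj₁ , (λ y∈A → <-trans x<m (All.lookup A>m y∈A)) ]′ (∈-push⁻ A y∈)

module _ {push} (isPush : IsPush push) (n : ℕ) where
  open IsPush isPush

  private
    accepted : ∀ {l} → ℕ → List ℕ → ℕ → Vec (Fin n) l → Bool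
    accepted m A k v = (lrMinima m (word v) ≡ᵇ k) ∧ greedy push m A (word v)

    countAfter : ∀ l → ℕ → List ℕ → ℕ → ℕ → ℕ
    countAfter l m A k x = count (λ (v : Vec (Fin n) l) →
      (lrMinima m (x ∷ word v) ≡ᵇ k) ∧ greedy push m A (x ∷ word v)) (allVecs (allFin n) l)

  count-greedy : ∀ l m A k → m ≤ n → All (m <_) A → All (_< n) A → l ≡ m + length A →
    count (accepted m A k) (allVecs (allFin n) l) ≡ pathsFrom m (length A) k

  private
    countAfter-newMin : ∀ l m A k {x} → m ≤ n → All (m <_) A → All (_< n) A →
      suc l ≡ m + length A → x < m → countAfter l m A k x ≡ newMinTerm l k x
    countAfter-newMin l m A k {x} m≤n A>m A<n 1+l≡ x<m = trans (count-cong (allVecs (allFin n) l) (unfold A)) (rest k)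
      where
      A′ = push x m A
      len : length A′ + x ≡ l
      len = suc-injective (trans (sym (+-suc (length A′) x)) (trans (length-push A x<m) (sym 1+l≡)))
      A′<n : All (_< n) A′
      A′<n = All.tabulate λ y∈ → [ (λ p → <-≤-trans (proj₂ p) m≤n) , All.lookup A<n ]′ (∈-push⁻ A y∈)
      -- `greedy` inspects `A` before it compares `x` with `m`, hence two clauses with the same
      -- outcome.
      unfold : ∀ A (v : Vec (Fin n) l) →
        (lrMinima m (x ∷ word v) ≡ᵇ k) ∧ greedy push m A (x ∷ word v)
          ≡ (suc (lrMinima x (word v)) ≡ᵇ k) ∧ greedy push x (push x m A) (word v)
      unfold []      v rewrite <⇒<ᵇ≡true x<m = refl
      unfold (a ∷ A) v rewrite <⇒<ᵇ≡true x<m = refl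
      rest : ∀ k → count (λ (v : Vec (Fin n) l) → (suc (lrMinima x (word v)) ≡ᵇ k) ∧ greedy push x A′ (word v))
               (allVecs (allFin n) l) ≡ newMinTerm l k x
      rest zero    = count-none (allVecs (allFin n) l) (λ v → refl)
      rest (suc k) = trans
        (count-greedy l x A′ k (≤-trans (<⇒≤ x<m) m≤n) (pushed>x x<m A>m) A′<n (trans (sym len) (+-comm (length A′) x)))
        (cong (λ z → pathsFrom x z k) (trans (sym (m+n∸n≡m (length A′) x)) (cong (_∸ x) len)))

    countAfter-stuck : ∀ l m k {x} → m ≤ x → countAfter l m [] k x ≡ 0
    countAfter-stuck l m k {x} m≤x = count-none (allVecs (allFin n) l) λ v →
      trans (cong (λ b → (lrMinima m (x ∷ word v) ≡ᵇ k) ∧ (b ∧ greedy push x (push x m []) (word v)))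
                  (≮⇒<ᵇ≡false (≤⇒≯ m≤x)))
            (∧-zeroʳ _)

    countAfter-wrong : ∀ l m a A k {x} → m ≤ x → x ≢ a → countAfter l m (a ∷ A) k x ≡ 0
    countAfter-wrong l m a A k {x} m≤x x≢a = count-none (allVecs (allFin n) l) no-word
      where
      no-word : ∀ (v : Vec (Fin n) l) →
        (lrMinima m (x ∷ word v) ≡ᵇ k) ∧ greedy push m (a ∷ A) (x ∷ word v) ≡ false
      no-word v rewrite ≮⇒<ᵇ≡false (≤⇒≯ m≤x) | ≢⇒≡ᵇ≡false x≢a = ∧-zeroʳ _

    countAfter-pop : ∀ l m a A k → m < a →
      countAfter l m (a ∷ A) k a ≡ count (accepted m A k) (allVecs (allFin n) l)
    countAfter-pop l m a A k m<a = count-cong (allVecs (allFin n) l) unfold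
      where
      unfold : ∀ (v : Vec (Fin n) l) →
        (lrMinima m (a ∷ word v) ≡ᵇ k) ∧ greedy push m (a ∷ A) (a ∷ word v) ≡ accepted m A k v
      unfold v rewrite ≮⇒<ᵇ≡false (<⇒≯ m<a) | ≡ᵇ-refl a = refl

    count-first-letter : ∀ l m A k → count (accepted m A k) (allVecs (allFin n) (suc l)) ≡ sumBelow n (countAfter l m A k)
    count-first-letter l m A k = trans (count-allVecs-suc (accepted m A k) (allFin n)) (sum-allFin n (countAfter l m A k))

  count-greedy zero zero    []      zero    m≤n A>m A<n l≡ = refl
  count-greedy zero zero    []      (suc k) m≤n A>m A<n l≡ = refl
  count-greedy (suc l) (suc m) [] k m≤n A>m A<n l≡ = begin
    count (accepted (suc m) [] k) (allVecs (allFin n) (suc l))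
      ≡⟨ count-first-letter l (suc m) [] k ⟩
    sumBelow n (countAfter l (suc m) [] k)
      ≡⟨ sumBelow-extend n m≤n (λ m≤x _ → countAfter-stuck l (suc m) k m≤x) ⟩
    sumBelow (suc m) (countAfter l (suc m) [] k)
      ≡⟨ sumBelow-cong (suc m) (countAfter-newMin l (suc m) [] k m≤n A>m A<n l≡) ⟩
    sumBelow (suc m) (newMinTerm l k)
      ≡⟨ cong (λ z → sumBelow (suc m) (newMinTerm z k)) (trans (suc-injective l≡) (+-identityʳ m)) ⟩
    sumBelow (suc m) (newMinTerm m k)
      ≡⟨ pathsFrom-zero-sum m k ⟨
    pathsFrom (suc m) 0 k ∎
    where open ≡-Reasoning
  count-greedy (suc l) m (a ∷ A) k m≤n (m<a ∷ A>m) (a<n ∷ A<n) l≡ = begin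
    count (accepted m (a ∷ A) k) (allVecs (allFin n) (suc l))
      ≡⟨ count-first-letter l m (a ∷ A) k ⟩
    sumBelow n (countAfter l m (a ∷ A) k)
      ≡⟨ sumBelow-extend-one n (<⇒≤ m<a) a<n (countAfter-wrong l m a A k) ⟩
    sumBelow m (countAfter l m (a ∷ A) k) + countAfter l m (a ∷ A) k a
      ≡⟨ cong₂ _+_ (sumBelow-cong m (countAfter-newMin l m (a ∷ A) k m≤n (m<a ∷ A>m) (a<n ∷ A<n) l≡))
                   (trans (countAfter-pop l m a A k m<a) (count-greedy l m A k m≤n A>m A<n l≡m+|A|)) ⟩
    sumBelow m (newMinTerm l k) + pathsFrom m (length A) k
      ≡⟨ cong (λ z → sumBelow m (newMinTerm z k) + pathsFrom m (length A) k) (trans l≡m+|A| (+-comm m (length A))) ⟩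
    sumBelow m (newMinTerm (length A + m) k) + pathsFrom m (length A) k
      ≡⟨ pathsFrom-suc-sum m (length A) k ⟨
    pathsFrom m (suc (length A)) k ∎
    where
    open ≡-Reasoning
    l≡m+|A| : l ≡ m + length A
    l≡m+|A| = suc-injective (trans l≡ (+-suc m (length A)))
  count-greedy zero    zero    (a ∷ A) k m≤n A>m A<n ()
  count-greedy zero    (suc m) A       k m≤n A>m A<n ()
  count-greedy (suc l) zero    []      k m≤n A>m A<n ()

-- Pattern avoidance

T-not⁺ : ∀ {b} → ¬ T b → T (not b)
T-not⁺ {true}  ¬t = ¬t tt
T-not⁺ {false} _  = tt

T-not⁻ : ∀ {b} → T (not b) → ¬ T b
T-not⁻ {true} ()

T-∧⁺ : ∀ {a b} → T a → T b → T (a ∧ b)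
T-∧⁺ p q = Equivalence.from T-∧ (p , q)

T-∧⁻ : ∀ {a b} → T (a ∧ b) → T a × T b
T-∧⁻ = Equivalence.to T-∧

anyᵇ-none⁺ : ∀ {p : X → Bool} {xs} → All (λ x → ¬ T (p x)) xs → ¬ T (anyᵇ p xs)
anyᵇ-none⁺ (¬px ∷ ¬pxs) t = [ ¬px , anyᵇ-none⁺ ¬pxs ]′ (Equivalence.to T-∨ t)

anyᵇ-none⁻ : ∀ {p : X → Bool} xs → ¬ T (anyᵇ p xs) → All (λ x → ¬ T (p x)) xs
anyᵇ-none⁻ []       ¬t = []
anyᵇ-none⁻ (x ∷ xs) ¬t = (¬t ∘ Equivalence.from T-∨ ∘ inj₁) ∷ anyᵇ-none⁻ xs (¬t ∘ Equivalence.from T-∨ ∘ inj₂)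

distinct⁺ : ∀ {w} → Unique w → T (distinct w)
distinct⁺ []           = tt
distinct⁺ (x∉w ∷ w!) = T-∧⁺ (T-not⁺ (anyᵇ-none⁺ (All.map (λ x≢y → x≢y ∘ ≡ᵇ⇒≡ _ _) x∉w))) (distinct⁺ w!)

distinct⁻ : ∀ w → T (distinct w) → Unique w
distinct⁻ []      _ = []
distinct⁻ (x ∷ w) t =
  All.map (λ x≢y → x≢y ∘ ≡⇒≡ᵇ _ _) (anyᵇ-none⁻ w (T-not⁻ (proj₁ (T-∧⁻ {b = distinct w} t))))
  ∷ distinct⁻ w (proj₂ (T-∧⁻ t))

Avoid : (ℕ → ℕ → ℕ → Bool) → List ℕ → Set
Avoid r []      = ⊤
Avoid r (a ∷ w) = AllPairs (λ b c → ¬ T (r a b c)) w × Avoid r w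

anyPair-none⁺ : ∀ {r : ℕ → ℕ → Bool} {w} → AllPairs (λ b c → ¬ T (r b c)) w → ¬ T (anyPair r w)
anyPair-none⁺ (¬b ∷ ¬w) t = [ anyᵇ-none⁺ ¬b , anyPair-none⁺ ¬w ]′ (Equivalence.to T-∨ t)

anyPair-none⁻ : ∀ {r : ℕ → ℕ → Bool} w → ¬ T (anyPair r w) → AllPairs (λ b c → ¬ T (r b c)) w
anyPair-none⁻ []      ¬t = []
anyPair-none⁻ (b ∷ w) ¬t =
  anyᵇ-none⁻ w (¬t ∘ Equivalence.from T-∨ ∘ inj₁) ∷ anyPair-none⁻ w (¬t ∘ Equivalence.from T-∨ ∘ inj₂)

avoids⁺ : ∀ {r} w → Avoid r w → T (avoids r w)
avoids⁺ {r} w av = T-not⁺ (none w av)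
  where
  none : ∀ w → Avoid r w → ¬ T (occurs r w)
  none (a ∷ w) (¬a , av) t = [ anyPair-none⁺ ¬a , none w av ]′ (Equivalence.to T-∨ t)

avoids⁻ : ∀ {r} w → T (avoids r w) → Avoid r w
avoids⁻ {r} w t = avoid w (T-not⁻ t)
  where
  avoid : ∀ w → ¬ T (occurs r w) → Avoid r w
  avoid []      ¬t = tt
  avoid (a ∷ w) ¬t =
    anyPair-none⁻ w (¬t ∘ Equivalence.from T-∨ ∘ inj₁) , avoid w (¬t ∘ Equivalence.from T-∨ ∘ inj₂)

-- The pigeonhole principle behind the finiteness arguments: words exhaust the values, orbits close
-- up, and injections transfer counts.
unique-⊆⇒length≤ : ∀ {xs ys : List X} → Unique xs → (∀ {x} → x ∈ xs → x ∈ ys) → length xs ≤ length ys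
unique-⊆⇒length≤ [] _ = z≤n
unique-⊆⇒length≤ {xs = x ∷ xs} (x∉xs ∷ xs!) xs⊆ys with ∈-∃++ (xs⊆ys (here refl))
... | as , bs , refl = subst (suc (length xs) ≤_) (sym (length-++-sucʳ as x bs))
                             (s≤s (unique-⊆⇒length≤ xs! xs⊆as++bs))
  where
  xs⊆as++bs : ∀ {y} → y ∈ xs → y ∈ as ++ bs
  xs⊆as++bs y∈xs with ∈-++⁻ as (xs⊆ys (there y∈xs))
  ... | inj₁ y∈as         = ∈-++⁺ˡ y∈as
  ... | inj₂ (here refl)  = contradiction refl (All.lookup x∉xs y∈xs)
  ... | inj₂ (there y∈bs) = ∈-++⁺ʳ as y∈bs

unique-covers : ∀ {n w} → Unique w → All (_< n) w → length w ≡ n → ∀ {y} → y < n → y ∈ w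
unique-covers {n} {w} w! w<n |w|≡n {y} y<n with y ∈? w
... | yes y∈w = y∈w
... | no  y∉w = contradiction (≤-trans (unique-⊆⇒length≤ (Allₚ.¬Any⇒All¬ w y∉w ∷ w!) below)
                                       (≤-reflexive (trans (length-upTo n) (sym |w|≡n))))
                              1+n≰n
  where
  below : ∀ {z} → z ∈ y ∷ w → z ∈ upTo n
  below (here refl) = ∈-upTo⁺ y<n
  below (there z∈w) = ∈-upTo⁺ (All.lookup w<n z∈w)

length-word : ∀ {n l} (v : Vec (Fin n) l) → length (word v) ≡ l
length-word []ᵥ      = refl
length-word (x ∷ᵥ v) = cong suc (length-word v)

word-< : ∀ {n l} (v : Vec (Fin n) l) → All (_< n) (word v)
word-< []ᵥ      = []
word-< (x ∷ᵥ v) = toℕ<n x ∷ word-< v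

-- Both 132 and 123 forbid, among the letters above a given one, two letters
-- b … c with c ⊏ b; for 132 the order ⊏ is <, for 123 it is >.
record GreedyPattern (r : ℕ → ℕ → ℕ → Bool) (_⊏_ : ℕ → ℕ → Set)
                     (push : ℕ → ℕ → List ℕ → List ℕ) : Set where
  field
    isPush      : IsPush push
    pattern⁺    : ∀ {a b c} → a < b → a < c → c ⊏ b → T (r a b c)
    pattern⁻    : ∀ {a b c} → T (r a b c) → a < b × a < c × c ⊏ b
    ⊏-asym      : ∀ {a b} → a ⊏ b → ¬ (b ⊏ a)
    push-sorted : ∀ {x m A} → x < m → All (m <_) A → AllPairs _⊏_ A → AllPairs _⊏_ (push x m A)

module _ {r _⊏_ push} (greedyPattern : GreedyPattern r _⊏_ push) where
  open GreedyPattern greedyPattern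
  open IsPush isPush

  private
    -- The invariant for the unread part `w`. Remembering `m` alone suffices: `m` is at most every
    -- letter read, so if any of them leads an occurrence ending in two letters of `w`, then so does
    -- `m`.
    record Completion (m : ℕ) (A w : List ℕ) : Set where
      constructor completion
      field
        unique   : Unique w
        complete : ∀ {y} → y < m ⊎ y ∈ A → y ∈ w
        sound    : ∀ {y} → y ∈ w → y < m ⊎ y ∈ A
        avoid    : Avoid r (m ∷ w)

    weaken : ∀ {a a′ w} → a′ ≤ a → AllPairs (λ b c → ¬ T (r a′ b c)) w → AllPairs (λ b c → ¬ T (r a b c)) w
    weaken a′≤a = AllPairs.map λ ¬p p → let a<b , a<c , c⊏b = pattern⁻ p in
      ¬p (pattern⁺ (≤-<-trans a′≤a a<b) (≤-<-trans a′≤a a<c) c⊏b)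

    tail-∈ : ∀ {x y : ℕ} {w} → y ≢ x → y ∈ x ∷ w → y ∈ w
    tail-∈ y≢x (here y≡x)  = contradiction y≡x y≢x
    tail-∈ y≢x (there y∈w) = y∈w

    completion-newMin⁻ : ∀ {m A x w} → x < m → All (m <_) A → Completion m A (x ∷ w) → Completion x (push x m A) w
    completion-newMin⁻ {m} {A} {x} {w} x<m A>m (completion (x∉w ∷ w!) complete sound avoid) =
      completion w! complete′ sound′ (proj₂ avoid)
      where
      complete′ : ∀ {y} → y < x ⊎ y ∈ push x m A → y ∈ w
      complete′ (inj₁ y<x) = tail-∈ (<⇒≢ y<x) (complete (inj₁ (<-trans y<x x<m)))
      complete′ (inj₂ y∈) with ∈-push⁻ A y∈
      ... | inj₁ (x<y , y<m) = tail-∈ (>⇒≢ x<y) (complete (inj₁ y<m))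
      ... | inj₂ y∈A = tail-∈ (>⇒≢ (<-trans x<m (All.lookup A>m y∈A))) (complete (inj₂ y∈A))
      sound′ : ∀ {y} → y ∈ w → y < x ⊎ y ∈ push x m A
      sound′ {y} y∈w with sound (there y∈w)
      ... | inj₂ y∈A = inj₂ (∈-push⁺ʳ A y∈A)
      ... | inj₁ y<m with y <? x
      ...   | yes y<x = inj₁ y<x
      ...   | no  y≮x = inj₂ (∈-push⁺ˡ A (≤∧≢⇒< (≮⇒≥ y≮x) (All.lookup x∉w y∈w)) y<m)

    -- The old minimum leads no occurrence through `x`, which lies below it, and none inside `w`,
    -- where `x` would lead one too.
    completion-newMin⁺ : ∀ {m A x w} → x < m → All (m <_) A → Completion x (push x m A) w → Completion m A (x ∷ w)
    completion-newMin⁺ {m} {A} {x} {w} x<m A>m (completion w! complete sound (¬x , av)) =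
      completion (All.tabulate x≢ ∷ w!) complete′ sound′
        ((All.tabulate (λ _ p → <-asym x<m (proj₁ (pattern⁻ p))) ∷ weaken (<⇒≤ x<m) ¬x) , ¬x , av)
      where
      x≢ : ∀ {y} → y ∈ w → x ≢ y
      x≢ y∈w refl with sound y∈w
      ... | inj₁ x<x = <-irrefl refl x<x
      ... | inj₂ x∈  = <-irrefl refl (All.lookup (pushed>x x<m A>m) x∈)
      complete′ : ∀ {y} → y < m ⊎ y ∈ A → y ∈ x ∷ w
      complete′ (inj₂ y∈A) = there (complete (inj₂ (∈-push⁺ʳ A y∈A)))
      complete′ {y} (inj₁ y<m) with <-cmp y x
      ... | tri< y<x _ _ = there (complete (inj₁ y<x))
      ... | tri≈ _ y≡x _ = here y≡x
      ... | tri> _ _ x<y = there (complete (inj₂ (∈-push⁺ˡ A x<y y<m)))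
      sound′ : ∀ {y} → y ∈ x ∷ w → y < m ⊎ y ∈ A
      sound′ (here refl) = inj₁ x<m
      sound′ (there y∈w) with sound y∈w
      ... | inj₁ y<x = inj₁ (<-trans y<x x<m)
      ... | inj₂ y∈ = [ (inj₁ ∘ proj₂) , inj₂ ]′ (∈-push⁻ A y∈)

    ∉-sorted : ∀ {a A} → All (a ⊏_) A → a ∉ A
    ∉-sorted a⊏A a∈A = ⊏-asym (All.lookup a⊏A a∈A) (All.lookup a⊏A a∈A)

    completion-pop⁻ : ∀ {m a A w} → m < a → All (a ⊏_) A → Completion m (a ∷ A) (a ∷ w) → Completion m A w
    completion-pop⁻ {m} {a} {A} {w} m<a a⊏A (completion (a∉w ∷ w!) complete sound ((_ ∷ ¬m) , _ , av)) =
      completion w! complete′ sound′ (¬m , av)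
      where
      complete′ : ∀ {y} → y < m ⊎ y ∈ A → y ∈ w
      complete′ (inj₁ y<m) = tail-∈ (<⇒≢ (<-trans y<m m<a)) (complete (inj₁ y<m))
      complete′ (inj₂ y∈A) = tail-∈ (λ { refl → ∉-sorted a⊏A y∈A }) (complete (inj₂ (there y∈A)))
      sound′ : ∀ {y} → y ∈ w → y < m ⊎ y ∈ A
      sound′ y∈w with sound (there y∈w)
      ... | inj₁ y<m = inj₁ y<m
      ... | inj₂ y∈  = inj₂ (tail-∈ (All.lookup a∉w y∈w ∘ sym) y∈)

    completion-pop⁺ : ∀ {m a A w} → m < a → All (a ⊏_) A → Completion m A w → Completion m (a ∷ A) (a ∷ w)
    completion-pop⁺ {m} {a} {A} {w} m<a a⊏A (completion w! complete sound (¬m , av)) =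
      completion (All.tabulate a≢ ∷ w!) complete′ sound′
        ((All.tabulate ¬ma ∷ ¬m) , weaken (<⇒≤ m<a) ¬m , av)
      where
      a≢ : ∀ {y} → y ∈ w → a ≢ y
      a≢ y∈w refl with sound y∈w
      ... | inj₁ a<m = <-asym m<a a<m
      ... | inj₂ a∈A = ∉-sorted a⊏A a∈A
      ¬ma : ∀ {c} → c ∈ w → ¬ T (r m a c)
      ¬ma c∈w p with pattern⁻ p | sound c∈w
      ... | _ , m<c , _   | inj₁ c<m = <-asym m<c c<m
      ... | _ , _   , c⊏a | inj₂ c∈A = ⊏-asym (All.lookup a⊏A c∈A) c⊏a
      complete′ : ∀ {y} → y < m ⊎ y ∈ a ∷ A → y ∈ a ∷ w
      complete′ (inj₁ y<m)          = there (complete (inj₁ y<m))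
      complete′ (inj₂ (here y≡a))   = here y≡a
      complete′ (inj₂ (there y∈A))  = there (complete (inj₂ y∈A))
      sound′ : ∀ {y} → y ∈ a ∷ w → y < m ⊎ y ∈ a ∷ A
      sound′ (here y≡a)  = inj₂ (here y≡a)
      sound′ (there y∈w) = [ inj₁ , (inj₂ ∘ there) ]′ (sound y∈w)

    -- The head a of A occurs later in w, so reading any other letter x of A
    -- first would create the forbidden occurrence m x a.
    completion-head : ∀ {m a A x w} → All (m <_) (a ∷ A) → All (a ⊏_) A → ¬ (x < m) →
                      Completion m (a ∷ A) (x ∷ w) → x ≡ a
    completion-head (m<a ∷ A>m) a⊏A x≮m (completion _ complete sound ((¬mx ∷ _) , _)) with sound (here refl)
    ... | inj₁ x<m         = contradiction x<m x≮m
    ... | inj₂ (here x≡a)  = x≡a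
    ... | inj₂ (there x∈A) with complete (inj₂ (here refl))
    ...   | here a≡x  = sym a≡x
    ...   | there a∈w = contradiction (pattern⁺ (All.lookup A>m x∈A) m<a (All.lookup a⊏A x∈A)) (All.lookup ¬mx a∈w)

    completion⇒greedy : ∀ m A w → All (m <_) A → AllPairs _⊏_ A → Completion m A w → T (greedy push m A w)
    completion⇒greedy zero    []      [] _ _ c = tt
    completion⇒greedy zero    (a ∷ A) [] _ _ c with Completion.complete c (inj₂ (here refl))
    ... | ()
    completion⇒greedy (suc m) A       [] _ _ c with Completion.complete c (inj₁ z<s)
    ... | ()
    completion⇒greedy m [] (x ∷ w) A>m A⊏ c with Completion.sound c (here refl)
    ... | inj₁ x<m rewrite <⇒<ᵇ≡true x<m =
      completion⇒greedy x (push x m []) w (pushed>x x<m A>m) (push-sorted x<m A>m A⊏) (completion-newMin⁻ x<m A>m c)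
    completion⇒greedy m (a ∷ A) (x ∷ w) A>m A⊏ c with x <? m
    ... | yes x<m rewrite <⇒<ᵇ≡true x<m =
      completion⇒greedy x (push x m (a ∷ A)) w (pushed>x x<m A>m) (push-sorted x<m A>m A⊏) (completion-newMin⁻ x<m A>m c)
    completion⇒greedy m (a ∷ A) (x ∷ w) A>m@(m<a ∷ A>m′) (a⊏A ∷ A⊏) c | no x≮m
      with refl ← completion-head A>m a⊏A x≮m c
      rewrite ≮⇒<ᵇ≡false x≮m | ≡ᵇ-refl x =
      completion⇒greedy m A w A>m′ A⊏ (completion-pop⁻ m<a a⊏A c)

    greedy⇒completion : ∀ m A w → All (m <_) A → AllPairs _⊏_ A → T (greedy push m A w) → Completion m A w
    greedy⇒completion zero [] [] _ _ t = completion [] [ (λ ()) , id ]′ (λ ()) ([] , tt)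
    greedy⇒completion m [] (x ∷ w) A>m A⊏ t with x <? m
    ... | no  x≮m rewrite ≮⇒<ᵇ≡false x≮m = ⊥-elim t
    ... | yes x<m rewrite <⇒<ᵇ≡true x<m = completion-newMin⁺ x<m A>m
      (greedy⇒completion x (push x m []) w (pushed>x x<m A>m) (push-sorted x<m A>m A⊏) t)
    greedy⇒completion m (a ∷ A) (x ∷ w) A>m A⊏ t with x <? m
    ... | yes x<m rewrite <⇒<ᵇ≡true x<m = completion-newMin⁺ x<m A>m
      (greedy⇒completion x (push x m (a ∷ A)) w (pushed>x x<m A>m) (push-sorted x<m A>m A⊏) t)
    greedy⇒completion m (a ∷ A) (x ∷ w) (m<a ∷ A>m) (a⊏A ∷ A⊏) t | no x≮m
      rewrite ≮⇒<ᵇ≡false x≮m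
      with refl ← ≡ᵇ⇒≡ x a (proj₁ (T-∧⁻ t)) =
      completion-pop⁺ m<a a⊏A (greedy⇒completion m A w A>m A⊏ (proj₂ (T-∧⁻ {x ≡ᵇ x} t)))

  isPerm∧avoids≡greedy : ∀ {n} (v : Vec (Fin n) n) → isPerm v ∧ avoids r (word v) ≡ greedy push n [] (word v)
  isPerm∧avoids≡greedy {n} v = T-ext to from
    where
    w = word v
    to : T (isPerm v ∧ avoids r w) → T (greedy push n [] w)
    to t = completion⇒greedy n [] w [] [] (completion w! complete sound (¬n , avoids⁻ w (proj₂ (T-∧⁻ {isPerm v} t))))
      where
      w! = distinct⁻ w (proj₁ (T-∧⁻ t))
      complete : ∀ {y} → y < n ⊎ y ∈ [] → y ∈ w
      complete (inj₁ y<n) = unique-covers w! (word-< v) (length-word v) y<n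
      sound : ∀ {y} → y ∈ w → y < n ⊎ y ∈ []
      sound y∈w = inj₁ (All.lookup (word-< v) y∈w)
      -- The initial bound is not a letter; exceeding all letters, it begins no occurrence.
      ¬n : AllPairs (λ b c → ¬ T (r n b c)) w
      ¬n = above (word-< v)
        where
        above : ∀ {u} → All (_< n) u → AllPairs (λ b c → ¬ T (r n b c)) u
        above []          = []
        above (b<n ∷ u<n) = All.tabulate (λ _ p → <-asym b<n (proj₁ (pattern⁻ p))) ∷ above u<n
    from : T (greedy push n [] w) → T (isPerm v ∧ avoids r w)
    from t = T-∧⁺ (distinct⁺ unique) (avoids⁺ w (proj₂ avoid))
      where open Completion (greedy⇒completion n [] w [] [] t)

  count-avoiders : ∀ n k →
    count (λ v → (lrMinima n (word v) ≡ᵇ k) ∧ avoids r (word v)) (perms n) ≡ pathsFrom n 0 k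
  count-avoiders n k = begin
    count (λ v → lrs v ∧ avoids r (word v)) (perms n)
      ≡⟨ count-filter (λ v → lrs v ∧ avoids r (word v)) isPerm (allVecs (allFin n) n) ⟩
    count (λ v → isPerm v ∧ (lrs v ∧ avoids r (word v))) (allVecs (allFin n) n)
      ≡⟨ count-cong (allVecs (allFin n) n) rearrange ⟩
    count (λ v → lrs v ∧ greedy push n [] (word v)) (allVecs (allFin n) n)
      ≡⟨ count-greedy isPush n n n [] k ≤-refl [] [] (sym (+-identityʳ n)) ⟩
    pathsFrom n 0 k ∎
    where
    open ≡-Reasoning
    lrs : Vec (Fin n) n → Bool
    lrs v = lrMinima n (word v) ≡ᵇ k
    rearrange : ∀ v → isPerm v ∧ (lrs v ∧ avoids r (word v)) ≡ lrs v ∧ greedy push n [] (word v)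
    rearrange v = begin
      isPerm v ∧ (lrs v ∧ avoids r (word v)) ≡⟨ ∧-assoc (isPerm v) (lrs v) _ ⟨
      (isPerm v ∧ lrs v) ∧ avoids r (word v) ≡⟨ cong (_∧ avoids r (word v)) (∧-comm (isPerm v) (lrs v)) ⟩
      (lrs v ∧ isPerm v) ∧ avoids r (word v) ≡⟨ ∧-assoc (lrs v) (isPerm v) _ ⟩
      lrs v ∧ (isPerm v ∧ avoids r (word v)) ≡⟨ cong (lrs v ∧_) (isPerm∧avoids≡greedy v) ⟩
      lrs v ∧ greedy push n [] (word v)      ∎

-- The patterns 132 and 123

between⁺ : ∀ {x m y} → x < y → y < m → ∃[ i ] i < m ∸ suc x × y ≡ suc x + i
between⁺ {x} {y = y} x<y y<m = y ∸ suc x , ∸-monoˡ-< y<m x<y , sym (m+[n∸m]≡n x<y)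

between⁻ : ∀ {x m y} → ∃[ i ] i < m ∸ suc x × y ≡ suc x + i → x < y × y < m
between⁻ {x} {m} (i , i<m∸1+x , refl) =
  s≤s (m≤m+n x i) ,
  subst (suc x + i <_) (m+[n∸m]≡n (<⇒≤ (m∸n≢0⇒n<m {m} {suc x} (m<n⇒n≢0 i<m∸1+x)))) (+-monoʳ-< (suc x) i<m∸1+x)

length-between : ∀ {x m} c → x < m → (m ∸ suc x) + c + suc x ≡ m + c
length-between {x} {m} c x<m = begin
  (m ∸ suc x) + c + suc x   ≡⟨ +-assoc (m ∸ suc x) c (suc x) ⟩
  (m ∸ suc x) + (c + suc x) ≡⟨ cong ((m ∸ suc x) +_) (+-comm c (suc x)) ⟩
  (m ∸ suc x) + (suc x + c) ≡⟨ +-assoc (m ∸ suc x) (suc x) c ⟨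
  (m ∸ suc x) + suc x + c   ≡⟨ cong (_+ c) (m∸n+n≡m x<m) ⟩
  m + c                     ∎
  where open ≡-Reasoning

-- The skipped values lie below `m` and those in `A` above it. Keeping the list sorted by `⊏`
-- therefore puts them increasingly in front for 132, decreasingly at the back for 123.
push132 push123 : ℕ → ℕ → List ℕ → List ℕ
push132 x m A = applyUpTo (suc x +_) (m ∸ suc x) ++ A
push123 x m A = A ++ applyDownFrom (suc x +_) (m ∸ suc x)

isPush132 : IsPush push132
isPush132 = record
  { length-push = λ {x} {m} A x<m → trans
      (cong (_+ suc x) (trans (length-++ (applyUpTo (suc x +_) (m ∸ suc x)))
                              (cong (_+ length A) (length-applyUpTo (suc x +_) (m ∸ suc x)))))
      (length-between (length A) x<m)
  ; ∈-push⁺ˡ = λ {x} {m} A x<y y<m → let i , i< , y≡ = between⁺ x<y y<m in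
      ∈-++⁺ˡ (subst (_∈ applyUpTo (suc x +_) (m ∸ suc x)) (sym y≡) (∈-applyUpTo⁺ (suc x +_) i<))
  ; ∈-push⁺ʳ = λ {x} {m} A → ∈-++⁺ʳ (applyUpTo (suc x +_) (m ∸ suc x))
  ; ∈-push⁻ = λ {x} {m} A y∈ →
      [ inj₁ ∘ between⁻ ∘ ∈-applyUpTo⁻ (suc x +_) , inj₂ ]′ (∈-++⁻ (applyUpTo (suc x +_) (m ∸ suc x)) y∈)
  }

isPush123 : IsPush push123
isPush123 = record
  { length-push = λ {x} {m} A x<m → trans
      (cong (_+ suc x) (trans (length-++ A)
        (trans (cong (length A +_) (length-applyDownFrom (suc x +_) (m ∸ suc x))) (+-comm (length A) _))))
      (length-between (length A) x<m)
  ; ∈-push⁺ˡ = λ {x} {m} A x<y y<m → let i , i< , y≡ = between⁺ x<y y<m in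
      ∈-++⁺ʳ A (subst (_∈ applyDownFrom (suc x +_) (m ∸ suc x)) (sym y≡) (∈-applyDownFrom⁺ (suc x +_) i<))
  ; ∈-push⁺ʳ = λ A → ∈-++⁺ˡ
  ; ∈-push⁻ = λ {x} {m} A y∈ →
      [ inj₂ , inj₁ ∘ between⁻ ∘ ∈-applyDownFrom⁻ (suc x +_) ]′ (∈-++⁻ A y∈)
  }

greedyPattern132 : GreedyPattern pat132 _<_ push132
greedyPattern132 = record
  { isPush      = isPush132
  ; pattern⁺    = λ a<b a<c c<b → T-∧⁺ (<⇒<ᵇ a<c) (<⇒<ᵇ c<b)
  ; pattern⁻    = λ {a} {b} {c} t → let a<ᵇc , c<ᵇb = T-∧⁻ {a <ᵇ c} t
                                        a<c = <ᵇ⇒< a c a<ᵇc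
                                        c<b = <ᵇ⇒< c b c<ᵇb in <-trans a<c c<b , a<c , c<b
  ; ⊏-asym      = <-asym
  ; push-sorted = λ {x} {m} x<m A>m A⊏ →
      AllPairsₚ.++⁺ (AllPairsₚ.applyUpTo⁺₁ (suc x +_) (m ∸ suc x) (λ i<j _ → +-monoʳ-< (suc x) i<j)) A⊏
        (All.tabulate λ y∈ → All.map (<-trans (proj₂ (between⁻ (∈-applyUpTo⁻ (suc x +_) y∈)))) A>m)
  }

greedyPattern123 : GreedyPattern pat123 (λ a b → b < a) push123
greedyPattern123 = record
  { isPush      = isPush123
  ; pattern⁺    = λ a<b a<c b<c → T-∧⁺ (<⇒<ᵇ a<b) (<⇒<ᵇ b<c)
  ; pattern⁻    = λ {a} {b} {c} t → let a<ᵇb , b<ᵇc = T-∧⁻ {a <ᵇ b} t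
                                        a<b = <ᵇ⇒< a b a<ᵇb
                                        b<c = <ᵇ⇒< b c b<ᵇc in a<b , <-trans a<b b<c , b<c
  ; ⊏-asym      = <-asym
  ; push-sorted = λ {x} {m} x<m A>m A⊏ →
      AllPairsₚ.++⁺ A⊏ (AllPairsₚ.applyDownFrom⁺₁ (suc x +_) (m ∸ suc x) (λ j<i _ → +-monoʳ-< (suc x) j<i))
        (All.map (λ m<a → All.tabulate λ y∈ → <-trans (proj₂ (between⁻ (∈-applyDownFrom⁻ (suc x +_) y∈))) m<a) A>m)
  }

-- Descents of words avoiding 132

-- Here `a` is the last letter read. Since `A` is increasing, `a` stays below all of `A`, so taking
-- the head of `A` is an ascent, while a letter below `m` is also below `a` and makes a descent.
desList-greedy132 : ∀ m A w a → m ≤ a → All (m <_) A → AllPairs _<_ A → All (a <_) A →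
  T (greedy push132 m A w) → desList (a ∷ w) ≡ lrMinima m w
desList-greedy132 m A [] a m≤a A>m A< A>a t = refl
desList-greedy132 m A (x ∷ w) a m≤a A>m A< A>a t with x <? m
desList-greedy132 m [] (x ∷ w) a m≤a A>m A< A>a t | no x≮m rewrite ≮⇒<ᵇ≡false x≮m = ⊥-elim t
desList-greedy132 m (b ∷ A) (x ∷ w) a m≤a (m<b ∷ A>m) (b<A ∷ A<) (a<b ∷ A>a) t | no x≮m
  rewrite ≮⇒<ᵇ≡false x≮m
  with refl ← ≡ᵇ⇒≡ x b (proj₁ (T-∧⁻ t))
  rewrite ≮⇒<ᵇ≡false (<⇒≯ a<b)
  = desList-greedy132 m A w x (<⇒≤ m<b) A>m A< b<A (proj₂ (T-∧⁻ {x ≡ᵇ x} t))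
desList-greedy132 m A (x ∷ w) a m≤a A>m A< A>a t | yes x<m
  rewrite <⇒<ᵇ≡true x<m | <⇒<ᵇ≡true (<-≤-trans x<m m≤a)
  = cong suc (desList-greedy132 x (push132 x m A) w x ≤-refl A′>x
      (GreedyPattern.push-sorted greedyPattern132 x<m A>m A<) A′>x (accepted A t))
  where
  A′>x = IsPush.pushed>x isPush132 x<m A>m
  accepted : ∀ A → T (greedy push132 m A (x ∷ w)) → T (greedy push132 x (push132 x m A) w)
  accepted []      t rewrite <⇒<ᵇ≡true x<m = t
  accepted (a ∷ A) t rewrite <⇒<ᵇ≡true x<m = t

-- The extra 1 is the first letter, a minimum with no letter before it to descend from.
1+descents≡lrMinima : ∀ {n} (v : Vec (Fin n) n) → 1 ≤ n → T (isPerm v) → T (avoidsOneLine pat132 v) →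
  suc (descents v) ≡ lrMinima n (word v)
1+descents≡lrMinima {n} (x ∷ᵥ v) _ perm av
  with t ← subst T (isPerm∧avoids≡greedy greedyPattern132 (x ∷ᵥ v)) (T-∧⁺ perm av)
  rewrite <⇒<ᵇ≡true (toℕ<n x)
  = cong suc (desList-greedy132 (toℕ x) (push132 (toℕ x) n []) (word v) (toℕ x) ≤-refl A>x
      (GreedyPattern.push-sorted greedyPattern132 (toℕ<n x) [] []) A>x t)
  where A>x = IsPush.pushed>x isPush132 (toℕ<n x) []

-- Cycles

allᵇ⁺ : ∀ {p : X → Bool} {xs} → All (T ∘ p) xs → T (allᵇ p xs)
allᵇ⁺ []         = tt
allᵇ⁺ (px ∷ pxs) = T-∧⁺ px (allᵇ⁺ pxs)

allᵇ⁻ : ∀ {p : X → Bool} xs → T (allᵇ p xs) → All (T ∘ p) xs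
allᵇ⁻ []       t = []
allᵇ⁻ (x ∷ xs) t = proj₁ (T-∧⁻ t) ∷ allᵇ⁻ xs (proj₂ (T-∧⁻ t))

-- cycleRest is the auxiliary function local to cycleOf, which has no name
-- here. Unification recovers it from a permutation of pretendSuc n letters:
-- behind the abstraction barrier the remaining fuel n and the size
-- pretendSuc n are unrelated, so the local function can be generalised over both.
abstract
  pretendSuc : ℕ → ℕ
  pretendSuc n = suc n

mutual
  cycleRestAt : ∀ n (π : Vec (Fin (pretendSuc n)) (pretendSuc n)) → Fin (pretendSuc n) → List (Fin (pretendSuc n))
  cycleRestAt n π i = _

  abstract
    cycleOf-cycleRestAt : ∀ n (π : Vec (Fin (pretendSuc n)) (pretendSuc n)) i →
      cycleOf π i ≡ i ∷ (if toℕ (lookup π i) ≡ᵇ toℕ i then [] else lookup π i ∷ cycleRestAt n π i)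
    cycleOf-cycleRestAt n π i = refl

mutual
  cycleRest : ∀ {n} → Vec (Fin n) n → Fin n → ℕ → Fin n → List (Fin n)
  cycleRest π i fuel x = _

  cycleRestAt≡cycleRest : ∀ n (π : Vec (Fin (pretendSuc n)) (pretendSuc n)) i →
    cycleRestAt n π i ≡ cycleRest π i n (lookup π (lookup π i))
  cycleRestAt≡cycleRest n π i with lookup π (lookup π i)
  ... | x with pretendSuc n
  ...   | _ = refl

iterate-+ : ∀ (f : X → X) x a b → iterate f x (a + b) ≡ iterate f (iterate f x a) b
iterate-+ f x zero    b = refl
iterate-+ f x (suc a) b = iterate-+ f (f x) a b

iterate-suc : ∀ (f : X → X) x a → iterate f x (suc a) ≡ f (iterate f x a)
iterate-suc f x zero    = refl
iterate-suc f x (suc a) = iterate-suc f (f x) a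

iterate-injective : ∀ {f : X → X} → (∀ {x y} → f x ≡ f y → x ≡ y) →
                    ∀ a {x y} → iterate f x a ≡ iterate f y a → x ≡ y
iterate-injective inj zero    e = e
iterate-injective inj (suc a) e = inj (iterate-injective inj a e)

-- If f^a x = f^b x with a < b, then f^(b − a) x = x.
iterates-distinct : ∀ {f : X → X} → (∀ {x y} → f x ≡ f y → x ≡ y) → ∀ {x d} →
  (∀ {t} → t < d → iterate f x (suc t) ≢ x) → Unique (applyUpTo (iterate f x) (suc d))
iterates-distinct {f = f} inj {x} {d} ¬return = Uniqueₚ.applyUpTo⁺₁ (iterate f x) (suc d) distinct′
  where
  distinct′ : ∀ {a b} → a < b → b < suc d → iterate f x a ≢ iterate f x b
  distinct′ {a} {b} a<b b<1+d e = ¬return t<d (iterate-injective inj a (begin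
    iterate f (iterate f x (suc t)) a ≡⟨ iterate-+ f x (suc t) a ⟨
    iterate f x (suc t + a)           ≡⟨ cong (iterate f x) b≡ ⟩
    iterate f x b                     ≡⟨ e ⟨
    iterate f x a                     ∎))
    where
    open ≡-Reasoning
    t = b ∸ suc a
    b≡ : suc t + a ≡ b
    b≡ = trans (sym (+-suc t a)) (m∸n+n≡m a<b)
    t<d : t < d
    t<d = s<s⁻¹ (≤-<-trans (subst (suc t ≤_) b≡ (m≤m+n (suc t) a)) b<1+d)

applyUpTo-injective : ∀ (f g : ℕ → X) n → applyUpTo f n ≡ applyUpTo g n → ∀ {t} → t < n → f t ≡ g t
applyUpTo-injective f g (suc n) e {zero}  t<n = ∷-injectiveˡ e
applyUpTo-injective f g (suc n) e {suc t} t<n = applyUpTo-injective (f ∘ suc) (g ∘ suc) n (∷-injectiveʳ e) (s<s⁻¹ t<n)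

lookup-∈-word : ∀ {n l} (v : Vec (Fin n) l) a → toℕ (lookup v a) ∈ word v
lookup-∈-word (x ∷ᵥ v) zero    = here refl
lookup-∈-word (x ∷ᵥ v) (suc a) = there (lookup-∈-word v a)

lookup-injective : ∀ {n l} (v : Vec (Fin n) l) → Unique (word v) → ∀ {a b} → lookup v a ≡ lookup v b → a ≡ b
lookup-injective (x ∷ᵥ v) _         {zero}  {zero}  e = refl
lookup-injective (x ∷ᵥ v) (x∉v ∷ _) {zero}  {suc b} e =
  contradiction (cong toℕ e) (All.lookup x∉v (lookup-∈-word v b))
lookup-injective (x ∷ᵥ v) (x∉v ∷ _) {suc a} {zero}  e =
  contradiction (cong toℕ (sym e)) (All.lookup x∉v (lookup-∈-word v a))
lookup-injective (x ∷ᵥ v) (_ ∷ v!)  {suc a} {suc b} e = cong suc (lookup-injective v v! e)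

length-allFin : ∀ n → length (allFin n) ≡ n
length-allFin n = length-tabulate id

module Cycles {n} (π : Vec (Fin n) n) (π! : Unique (word π)) where

  private
    f : Fin n → Fin n
    f = lookup π

    f-injective : ∀ {x y} → f x ≡ f y → x ≡ y
    f-injective = lookup-injective π π!

    -- Either the loop stops at the first return to `i`, or the fuel runs out before any return; the
    -- second case is excluded only in `cycleOf-iterates`.
    cycleRest-run : ∀ i k x →
      (∃[ d ] cycleRest π i k x ≡ applyUpTo (iterate f x) d × iterate f x d ≡ i × (∀ {t} → t < d → iterate f x t ≢ i))
      ⊎ (∀ {t} → t < k → iterate f x t ≢ i)
    cycleRest-run i zero    x = inj₂ λ ()
    cycleRest-run i (suc k) x with toℕ x ≟ toℕ i
    ... | yes x≡i rewrite Equivalence.to T-≡ (≡⇒≡ᵇ _ _ x≡i) = inj₁ (0 , refl , toℕ-injective x≡i , λ ())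
    ... | no  x≢i rewrite ≢⇒≡ᵇ≡false x≢i with cycleRest-run i k (f x)
    ...   | inj₁ (d , rest≡ , return , ¬return) = inj₁ (suc d , cong (x ∷_) rest≡ , return ,
              λ { {zero} _ → x≢i ∘ cong toℕ ; {suc t} t<d → ¬return (s<s⁻¹ t<d) })
    ...   | inj₂ ¬return = inj₂ λ { {zero} _ → x≢i ∘ cong toℕ ; {suc t} t<k → ¬return (s<s⁻¹ t<k) }

  cycleOf-iterates : ∀ i → ∃[ d ] cycleOf π i ≡ applyUpTo (iterate f i) (suc d) × iterate f i (suc d) ≡ i
                                × (∀ {t} → t < d → iterate f i (suc t) ≢ i)
  cycleOf-iterates i with cycleRest-run i n (f i)
  ... | inj₁ (d , rest≡ , return , ¬return) = d , cong (i ∷_) rest≡ , return , ¬return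
  -- Otherwise `i` and its first `n` iterates would be `n + 1` distinct elements of `Fin n`.
  ... | inj₂ ¬return = contradiction
    (≤-trans (≤-reflexive (sym (length-applyUpTo (iterate f i) (suc n))))
      (≤-trans (unique-⊆⇒length≤ (iterates-distinct f-injective {i} {n} ¬return) (λ {x} _ → ∈-allFin x))
               (≤-reflexive (length-allFin n))))
    1+n≰n

  cycleOf-unique : ∀ i → Unique (cycleOf π i)
  cycleOf-unique i with cycleOf-iterates i
  ... | d , cycle≡ , _ , ¬return = subst Unique (sym cycle≡) (iterates-distinct f-injective ¬return)

  private
    Reaches : Fin n → Fin n → Set
    Reaches x y = ∃[ s ] iterate f x s ≡ y

    reaches-trans : ∀ {x y z} → Reaches x y → Reaches y z → Reaches x z
    reaches-trans {x} (s , refl) (t , refl) = s + t , iterate-+ f x s t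

    ∈-cycleOf⇒reaches : ∀ {i x} → x ∈ cycleOf π i → Reaches i x
    ∈-cycleOf⇒reaches {i} {x} x∈ with cycleOf-iterates i
    ... | d , cycle≡ , _ with ∈-applyUpTo⁻ (iterate f i) (subst (x ∈_) cycle≡ x∈)
    ...   | s , _ , x≡ = s , sym x≡

    -- The listed iterates are closed under `f`: each goes to the next one, the last back to `i`.
    reaches⇒∈-cycleOf : ∀ {i x} → Reaches i x → x ∈ cycleOf π i
    reaches⇒∈-cycleOf {i} (s , refl) with cycleOf-iterates i
    ... | d , cycle≡ , return , _ = subst (iterate f i s ∈_) (sym cycle≡) (visited s)
      where
      visited : ∀ s → iterate f i s ∈ applyUpTo (iterate f i) (suc d)
      visited zero    = ∈-applyUpTo⁺ (iterate f i) z<s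
      visited (suc s) with ∈-applyUpTo⁻ (iterate f i) (visited s)
      ... | t , t<1+d , e with m≤n⇒m<n∨m≡n (s≤s⁻¹ t<1+d)
      ...   | inj₁ t<d  = subst (_∈ applyUpTo (iterate f i) (suc d)) (sym next) (∈-applyUpTo⁺ (iterate f i) (s<s t<d))
        where next = trans (iterate-suc f i s) (trans (cong f e) (sym (iterate-suc f i t)))
      ...   | inj₂ refl = subst (_∈ applyUpTo (iterate f i) (suc d)) (sym next) (∈-applyUpTo⁺ (iterate f i) z<s)
        where next = trans (iterate-suc f i s) (trans (cong f e) (trans (sym (iterate-suc f i t)) return))

    reaches-sym : ∀ {i x} → Reaches i x → Reaches x i
    reaches-sym {i} {x} i↝x with cycleOf-iterates i
    ... | d , cycle≡ , return , _ with ∈-applyUpTo⁻ (iterate f i) (subst (x ∈_) cycle≡ (reaches⇒∈-cycleOf i↝x))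
    ...   | t , t<1+d , refl = suc d ∸ t ,
      trans (sym (iterate-+ f i t (suc d ∸ t))) (trans (cong (iterate f i) (m+[n∸m]≡n (<⇒≤ t<1+d))) return)

  cycleMin-≤ : ∀ {i} → T (isCycleMin π i) → ∀ {x} → x ∈ cycleOf π i → toℕ i ≤ toℕ x
  cycleMin-≤ {i} min x∈ = ≤ᵇ⇒≤ _ _ (All.lookup (allᵇ⁻ (cycleOf π i) min) x∈)

  -- By descent: a `y` that is not minimal has a smaller `z` in its cycle, and `z` still reaches `x`
  -- because reachability is symmetric.
  cycleMin-exists : ∀ x → ∃[ i ] T (isCycleMin π i) × x ∈ cycleOf π i
  cycleMin-exists x = descend x (<-wellFounded (toℕ x)) (0 , refl)
    where
    descend : ∀ y → Acc _<_ (toℕ y) → Reaches y x → ∃[ i ] T (isCycleMin π i) × x ∈ cycleOf π i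
    descend y (acc rec) y↝x with All.all? (λ z → T? (toℕ y ≤ᵇ toℕ z)) (cycleOf π y)
    ... | yes min = y , allᵇ⁺ min , reaches⇒∈-cycleOf y↝x
    ... | no ¬min with find (Allₚ.¬All⇒Any¬ (λ z → T? (toℕ y ≤ᵇ toℕ z)) (cycleOf π y) ¬min)
    ...   | z , z∈ , ¬y≤z = descend z (rec (≰⇒> (¬y≤z ∘ ≤⇒≤ᵇ)))
                                   (reaches-trans (reaches-sym (∈-cycleOf⇒reaches z∈)) y↝x)

  -- If the cycles met, each minimum would lie in the cycle of the other and bound it from below.
  cycleMins-disjoint : ∀ {i j} → T (isCycleMin π i) → T (isCycleMin π j) → i ≢ j → Disjoint (cycleOf π i) (cycleOf π j)
  cycleMins-disjoint min-i min-j i≢j (x∈i , x∈j) = i≢j (toℕ-injective (≤-antisym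
    (cycleMin-≤ min-i (reaches⇒∈-cycleOf (reaches-trans i↝x (reaches-sym j↝x))))
    (cycleMin-≤ min-j (reaches⇒∈-cycleOf (reaches-trans j↝x (reaches-sym i↝x))))))
    where
    i↝x = ∈-cycleOf⇒reaches x∈i
    j↝x = ∈-cycleOf⇒reaches x∈j

-- The standard cycle form

allPairs-map : ∀ {P : X → Set} {R S : X → X → Set} {xs} →
  (∀ {x y} → P x → P y → R x y → S x y) → All P xs → AllPairs R xs → AllPairs S xs
allPairs-map imp []         []         = []
allPairs-map imp (px ∷ pxs) (Rx ∷ Rxs) =
  All.zipWith (λ (py , Rxy) → imp px py Rxy) (pxs , Rx) ∷ allPairs-map imp pxs Rxs

allPairs-reverse : ∀ {R : X → X → Set} {xs} → AllPairs R xs → AllPairs (λ x y → R y x) (reverse xs)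
allPairs-reverse [] = []
allPairs-reverse {R = R} {xs = x ∷ xs} (Rx ∷ Rxs) = subst (AllPairs _) (sym (unfold-reverse x xs))
  (AllPairsₚ.++⁺ (allPairs-reverse Rxs) ([] ∷ [])
    (All.tabulate (λ y∈ → All.lookup Rx (Anyₚ.reverse⁻ y∈) ∷ [])))

-- Retains what makes erased parentheses recoverable: a block starts exactly where the word drops
-- below `m`, the head of the preceding block.
data Blocks : ℕ → List (List ℕ) → Set where
  []  : ∀ {m} → Blocks m []
  _∷_ : ∀ {m i c cs} → i < m × All (i <_) c → Blocks i cs → Blocks m ((i ∷ c) ∷ cs)

lrMinima-concat : ∀ {m cs} → Blocks m cs → lrMinima m (concat cs) ≡ length cs
lrMinima-concat [] = refl
lrMinima-concat {cs = (i ∷ c) ∷ cs} ((i<m , c>i) ∷ bs) rewrite <⇒<ᵇ≡true i<m =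
  cong suc (trans (skip c>i) (lrMinima-concat bs))
  where
  skip : ∀ {c} → All (i <_) c → lrMinima i (c ++ concat cs) ≡ lrMinima i (concat cs)
  skip []          = refl
  skip (i<x ∷ c>i) rewrite ≮⇒<ᵇ≡false (<⇒≯ i<x) = skip c>i

-- Two parses cannot diverge: a letter above the current head continues the block, a letter below it
-- opens the next.
concat-blocks-injective : ∀ {m m′ bs cs} → Blocks m bs → Blocks m′ cs → concat bs ≡ concat cs → bs ≡ cs
concat-blocks-injective [] [] _ = refl
concat-blocks-injective (_∷_ {i = i} (_ , b>i) Bs) ((_ , c>i) ∷ Cs) e with refl ← ∷-injectiveˡ e =
  let b≡c , rest≡ = split b>i c>i Bs Cs (∷-injectiveʳ e) in
  cong₂ _∷_ (cong (i ∷_) b≡c) (concat-blocks-injective Bs Cs rest≡)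
  where
  ends : ∀ {x w cs} → i < x → Blocks i cs → concat cs ≢ x ∷ w
  ends i<x ((j<i , _) ∷ _) e = <-asym i<x (subst (_< i) (∷-injectiveˡ e) j<i)
  split : ∀ {b c bs cs} → All (i <_) b → All (i <_) c → Blocks i bs → Blocks i cs →
          b ++ concat bs ≡ c ++ concat cs → b ≡ c × concat bs ≡ concat cs
  split []          []          Bs Cs e = refl , e
  split []          (i<x ∷ c>i) Bs Cs e = contradiction e (ends i<x Bs)
  split (i<x ∷ b>i) []          Bs Cs e = contradiction (sym e) (ends i<x Cs)
  split (_ ∷ b>i)   (_ ∷ c>i)   Bs Cs e with refl ← ∷-injectiveˡ e =
    let b≡c , rest≡ = split b>i c>i Bs Cs (∷-injectiveʳ e) in cong (_ ∷_) b≡c , rest≡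

cycleBlocks : ∀ {n} → Vec (Fin n) n → List (List ℕ)
cycleBlocks π = map (map toℕ ∘ cycleOf π) (cycleMins π)

Ψ≡concat-cycleBlocks : ∀ {n} (π : Vec (Fin n) n) → Ψ π ≡ concat (cycleBlocks π)
Ψ≡concat-cycleBlocks π =
  trans (sym (concat-map (map (cycleOf π) (cycleMins π)))) (cong concat (sym (map-∘ (cycleMins π))))

module StandardForm {n} (π : Vec (Fin n) n) (π! : Unique (word π)) where
  open Cycles π π! public

  ∈-cycleMins⁺ : ∀ {i} → T (isCycleMin π i) → i ∈ cycleMins π
  ∈-cycleMins⁺ {i} = ∈-filter⁺ (T? ∘ isCycleMin π) (Anyₚ.reverse⁺ (∈-allFin i))

  cycleMins-min : All (T ∘ isCycleMin π) (cycleMins π)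
  cycleMins-min = Allₚ.all-filter (T? ∘ isCycleMin π) (reverse (allFin n))

  cycleMins-decreasing : AllPairs (λ i j → toℕ j < toℕ i) (cycleMins π)
  cycleMins-decreasing = AllPairsₚ.filter⁺ (T? ∘ isCycleMin π) (allPairs-reverse (AllPairsₚ.tabulate⁺-< id))

  cycleBlocks-Blocks : Blocks n (cycleBlocks π)
  cycleBlocks-Blocks = build n (All.tabulate (λ {i} _ → toℕ<n i)) cycleMins-decreasing cycleMins-min
    where
    build : ∀ m {is} → All (λ i → toℕ i < m) is → AllPairs (λ i j → toℕ j < toℕ i) is →
            All (T ∘ isCycleMin π) is → Blocks m (map (map toℕ ∘ cycleOf π) is)
    build m []          []           []           = []
    build m {i ∷ _} (i<m ∷ _) (i>is ∷ is>) (min ∷ mins) = (i<m , rest>i) ∷ build (toℕ i) i>is is> mins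
      where
      rest>i = Allₚ.map⁺ (All.tabulate λ x∈ →
        ≤∧≢⇒< (cycleMin-≤ min (there x∈)) (All.lookup (AllPairs.head (cycleOf-unique i)) x∈ ∘ toℕ-injective))

  lrMinima-Ψ : lrMinima n (Ψ π) ≡ numCycles π
  lrMinima-Ψ = trans (cong (lrMinima n) (Ψ≡concat-cycleBlocks π))
                     (trans (lrMinima-concat cycleBlocks-Blocks) (length-map (map toℕ ∘ cycleOf π) (cycleMins π)))

  private
    letters : List (Fin n)
    letters = concatMap (cycleOf π) (cycleMins π)

    letters-unique : Unique letters
    letters-unique = Uniqueₚ.concat⁺ (Allₚ.map⁺ (All.tabulate (λ {i} _ → cycleOf-unique i)))
      (AllPairsₚ.map⁺ (allPairs-map (λ min-i min-j j<i → cycleMins-disjoint min-i min-j (λ { refl → <-irrefl refl j<i }))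
                                    cycleMins-min cycleMins-decreasing))

    letters-cover : ∀ x → x ∈ letters
    letters-cover x = let i , min , x∈ = cycleMin-exists x in
      ∈-concatMap⁺ (cycleOf π) (lose (∈-cycleMins⁺ min) x∈)

    length-letters : length letters ≡ n
    length-letters = trans
      (≤-antisym (unique-⊆⇒length≤ letters-unique (λ {x} _ → ∈-allFin x))
                 (unique-⊆⇒length≤ (Uniqueₚ.allFin⁺ n) (λ {x} _ → letters-cover x)))
      (length-allFin n)

  Ψ-perm : ∃[ v ] T (isPerm {n} v) × word v ≡ Ψ π
  Ψ-perm = v , distinct⁺ (subst Unique (sym word≡) (Uniqueₚ.map⁺ toℕ-injective letters-unique)) , word≡
    where
    -- The length is a variable here so that the equation can be matched with `refl`.
    vector : ∀ {l} (xs : List (Fin n)) → length xs ≡ l → ∃[ v ] toList {n = l} v ≡ xs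
    vector xs refl = fromList xs , Vecₚ.toList∘fromList xs
    v = proj₁ (vector letters length-letters)
    word≡ : word v ≡ Ψ π
    word≡ = cong (map toℕ) (proj₂ (vector letters length-letters))

-- Equal words have equal blocks, so both permutations list the same cycles, and every `x` lies in
-- one of them, where its image can be read off.
Ψ-injective : ∀ {n} (π ρ : Vec (Fin n) n) → Unique (word π) → Unique (word ρ) → Ψ π ≡ Ψ ρ → π ≡ ρ
Ψ-injective {n} π ρ π! ρ! Ψ≡ = begin
  π                           ≡⟨ Vecₚ.tabulate∘lookup π ⟨
  Vec.tabulate (lookup π) ≡⟨ Vecₚ.tabulate-cong same ⟩
  Vec.tabulate (lookup ρ) ≡⟨ Vecₚ.tabulate∘lookup ρ ⟩
  ρ                           ∎
  where
  open ≡-Reasoning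
  module P = StandardForm π π!
  module R = StandardForm ρ ρ!

  blocks≡ : cycleBlocks π ≡ cycleBlocks ρ
  blocks≡ = concat-blocks-injective P.cycleBlocks-Blocks R.cycleBlocks-Blocks
    (trans (sym (Ψ≡concat-cycleBlocks π)) (trans Ψ≡ (Ψ≡concat-cycleBlocks ρ)))

  cycle≡ : ∀ {i} → T (isCycleMin π i) → cycleOf π i ≡ cycleOf ρ i
  cycle≡ {i} min
    with j , _ , e ← ∈-map⁻ (map toℕ ∘ cycleOf ρ) (subst (map toℕ (cycleOf π i) ∈_) blocks≡
                       (∈-map⁺ (map toℕ ∘ cycleOf π) (P.∈-cycleMins⁺ min)))
    with e′ ← map-injective toℕ-injective e
    -- The matching block of `ρ` could start at another `j`; comparing heads gives `j = i`.
    with refl ← ∷-injectiveˡ e′ = e′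

  same : ∀ x → lookup π x ≡ lookup ρ x
  same x with P.cycleMin-exists x
  ... | i , min , x∈ with P.cycleOf-iterates i | R.cycleOf-iterates i
  ...   | d , π-cycle , π-return , _ | d′ , ρ-cycle , ρ-return , _
    with ∈-applyUpTo⁻ (iterate (lookup π) i) (subst (x ∈_) π-cycle x∈)
       | trans (sym π-cycle) (trans (cycle≡ min) ρ-cycle)
  ...     | t , t<1+d , refl | cycles≡
    with refl ← suc-injective (trans (sym (length-applyUpTo (iterate (lookup π) i) (suc d)))
                  (trans (cong length cycles≡) (length-applyUpTo (iterate (lookup ρ) i) (suc d′)))) = begin
    f (iterate f i t) ≡⟨ iterate-suc f i t ⟨
    iterate f i (suc t) ≡⟨ next (m≤n⇒m<n∨m≡n (s≤s⁻¹ t<1+d)) ⟩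
    iterate g i (suc t) ≡⟨ iterate-suc g i t ⟩
    g (iterate g i t) ≡⟨ cong g (agree t<1+d) ⟨
    g (iterate f i t) ∎
    where
    f = lookup π
    g = lookup ρ
    agree : ∀ {s} → s < suc d → iterate f i s ≡ iterate g i s
    agree = applyUpTo-injective (iterate f i) (iterate g i) (suc d) cycles≡
    -- The last entry of a cycle has no successor in the list, but both permutations send it back to
    -- `i`.
    next : t < d ⊎ t ≡ d → iterate f i (suc t) ≡ iterate g i (suc t)
    next (inj₁ t<d)  = agree (s<s t<d)
    next (inj₂ refl) = trans π-return (sym ρ-return)

-- Transfer of counts along Ψ

unique-map : ∀ {f : X → Y} {xs} → (∀ {x y} → x ∈ xs → y ∈ xs → f x ≡ f y → x ≡ y) → Unique xs → Unique (map f xs)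
unique-map inj []           = []
unique-map inj (x∉xs ∷ xs!) =
  Allₚ.map⁺ (All.tabulate (λ y∈ → All.lookup x∉xs y∈ ∘ inj (here refl) (there y∈)))
  ∷ unique-map (λ x∈ y∈ → inj (there x∈) (there y∈)) xs!

module _ {f : X → Y} {xs : List X} {ys : List Y} (xs! : Unique xs) (f∈ : ∀ {x} → x ∈ xs → f x ∈ ys)
         (inj : ∀ {x y} → x ∈ xs → y ∈ xs → f x ≡ f y → x ≡ y) where

  count-≤ : ∀ p → count (p ∘ f) xs ≤ count p ys
  count-≤ p = subst (_≤ count p ys) (length-map f zs) (unique-⊆⇒length≤
    (unique-map (λ x∈ y∈ → inj (proj₁ (selected x∈)) (proj₁ (selected y∈))) (Uniqueₚ.filter⁺ (T? ∘ p ∘ f) xs!)) image)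
    where
    zs = filterᵇ (p ∘ f) xs
    selected : ∀ {x} → x ∈ zs → x ∈ xs × T (p (f x))
    selected = ∈-filter⁻ (T? ∘ p ∘ f)
    image : ∀ {y} → y ∈ map f zs → y ∈ filterᵇ p ys
    image y∈ with x , x∈ , refl ← ∈-map⁻ f y∈ =
      ∈-filter⁺ (T? ∘ p) (f∈ (proj₁ (selected x∈))) (proj₂ (selected x∈))

  -- The inequality for the complement of p supplies the converse.
  count-bijection : length xs ≡ length ys → ∀ p → count (p ∘ f) xs ≡ count p ys
  count-bijection |xs|≡|ys| p = ≤-antisym (count-≤ p) (+-cancelʳ-≤ (count (not ∘ p ∘ f) xs) _ _ (begin
    count p ys + count (not ∘ p ∘ f) xs        ≤⟨ +-monoʳ-≤ (count p ys) (count-≤ (not ∘ p)) ⟩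
    count p ys + count (not ∘ p) ys            ≡⟨ count-complement p ys ⟩
    length ys                                  ≡⟨ |xs|≡|ys| ⟨
    length xs                                  ≡⟨ count-complement (p ∘ f) xs ⟨
    count (p ∘ f) xs + count (not ∘ p ∘ f) xs  ∎))
    where open ≤-Reasoning

∈-allVecs : ∀ {xs : List X} → (∀ x → x ∈ xs) → ∀ {l} (v : Vec X l) → v ∈ allVecs xs l
∈-allVecs all []ᵥ      = here refl
∈-allVecs all (x ∷ᵥ v) = ∈-concatMap⁺ _ (lose (all x) (∈-map⁺ (x ∷ᵥ_) (∈-allVecs all v)))

allVecs-unique : ∀ {xs : List X} → Unique xs → ∀ l → Unique (allVecs xs l)
allVecs-unique xs! zero    = [] ∷ []
allVecs-unique {xs = xs} xs! (suc l) = Uniqueₚ.concat⁺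
  (Allₚ.map⁺ (All.tabulate (λ _ → Uniqueₚ.map⁺ Vecₚ.∷-injectiveʳ (allVecs-unique xs! l))))
  (AllPairsₚ.map⁺ (AllPairs.map disjoint xs!))
  where
  disjoint : ∀ {x y} → x ≢ y → Disjoint (map (x ∷ᵥ_) (allVecs xs l)) (map (y ∷ᵥ_) (allVecs xs l))
  disjoint x≢y (v∈ , v∈′) with _ , _ , refl ← ∈-map⁻ (_ ∷ᵥ_) v∈ | _ , _ , e ← ∈-map⁻ (_ ∷ᵥ_) v∈′ =
    x≢y (Vecₚ.∷-injectiveˡ e)

perms-unique : ∀ n → Unique (perms n)
perms-unique n = Uniqueₚ.filter⁺ (T? ∘ isPerm) (allVecs-unique (Uniqueₚ.allFin⁺ n) n)

∈-perms⁺ : ∀ {n} (v : Vec (Fin n) n) → T (isPerm v) → v ∈ perms n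
∈-perms⁺ v = ∈-filter⁺ (T? ∘ isPerm) (∈-allVecs ∈-allFin v)

∈-perms⁻ : ∀ {n} {v : Vec (Fin n) n} → v ∈ perms n → T (isPerm v)
∈-perms⁻ {n} v∈ = proj₂ (∈-filter⁻ (T? ∘ isPerm) {xs = allVecs (allFin n) n} v∈)

perm-unique : ∀ {n} {v : Vec (Fin n) n} → v ∈ perms n → Unique (word v)
perm-unique {v = v} v∈ = distinct⁻ (word v) (∈-perms⁻ v∈)

-- Each `Ψ π` is the one-line word of some permutation, so `Ψ` injects `perms n` into a list of the
-- same length. Any property of words is thus equally frequent among standard cycle forms and among
-- one-line words.
count-Ψ : ∀ n (p : List ℕ → Bool) → count (p ∘ Ψ) (perms n) ≡ count (p ∘ word) (perms n)
count-Ψ n p = trans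
  (count-bijection (perms-unique n) Ψ∈
    (λ π∈ ρ∈ → Ψ-injective _ _ (perm-unique π∈) (perm-unique ρ∈))
    (sym (length-map word (perms n))) p)
  (count-map p word (perms n))
  where
  Ψ∈ : ∀ {π} → π ∈ perms n → Ψ π ∈ map word (perms n)
  Ψ∈ {π} π∈ with v , perm , word≡ ← StandardForm.Ψ-perm π (perm-unique π∈) =
    subst (_∈ map word (perms n)) word≡ (∈-map⁺ word (∈-perms⁺ v perm))

-- Comparison of the counts

count-cycAvoiders : ∀ {r _⊏_ push} → GreedyPattern r _⊏_ push → ∀ n k →
  count (λ π → (numCycles π ≡ᵇ k) ∧ cycAvoids r π) (perms n) ≡ pathsFrom n 0 k
count-cycAvoiders {r} gp n k = begin
  count (λ π → (numCycles π ≡ᵇ k) ∧ cycAvoids r π) (perms n)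
    ≡⟨ count-cong-∈ (perms n) (λ {π} π∈ →
         cong (λ c → (c ≡ᵇ k) ∧ cycAvoids r π) (sym (StandardForm.lrMinima-Ψ π (perm-unique π∈)))) ⟩
  count (λ π → (lrMinima n (Ψ π) ≡ᵇ k) ∧ avoids r (Ψ π)) (perms n)
    ≡⟨ count-Ψ n (λ w → (lrMinima n w ≡ᵇ k) ∧ avoids r w) ⟩
  count (λ π → (lrMinima n (word π) ≡ᵇ k) ∧ avoids r (word π)) (perms n)
    ≡⟨ count-avoiders gp n k ⟩
  pathsFrom n 0 k ∎
  where open ≡-Reasoning

count-132-avoiders-by-descents : ∀ n j → 1 ≤ n →
  count (λ π → avoidsOneLine pat132 π ∧ (descents π ≡ᵇ j)) (perms n) ≡ pathsFrom n 0 (suc j)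
count-132-avoiders-by-descents n j 1≤n =
  trans (count-cong-∈ (perms n) (λ {π} π∈ → T-ext (to π (∈-perms⁻ π∈)) (from π (∈-perms⁻ π∈))))
        (count-avoiders greedyPattern132 n (suc j))
  where
  to : ∀ π → T (isPerm π) → T (avoidsOneLine pat132 π ∧ (descents π ≡ᵇ j)) →
       T ((lrMinima n (word π) ≡ᵇ suc j) ∧ avoids pat132 (word π))
  to π perm t with av , des ← T-∧⁻ {avoidsOneLine pat132 π} t =
    T-∧⁺ (subst (λ c → T (c ≡ᵇ suc j)) (1+descents≡lrMinima π 1≤n perm av) des) av
  from : ∀ π → T (isPerm π) → T ((lrMinima n (word π) ≡ᵇ suc j) ∧ avoids pat132 (word π)) →
         T (avoidsOneLine pat132 π ∧ (descents π ≡ᵇ j))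
  from π perm t with lrs , av ← T-∧⁻ {lrMinima n (word π) ≡ᵇ suc j} t =
    T-∧⁺ av (subst (λ c → T (c ≡ᵇ suc j)) (sym (1+descents≡lrMinima π 1≤n perm av)) lrs)

mainTheorem13 : (n k : ℕ) → 1 ≤ n → 1 ≤ k → k ≤ n →
    (count (λ π → (numCycles π ≡ᵇ k) ∧ cycAvoids pat132 π) (perms n)
      ≡ count (λ π → (numCycles π ≡ᵇ k) ∧ cycAvoids pat123 π) (perms n))
    × (count (λ π → (numCycles π ≡ᵇ k) ∧ cycAvoids pat123 π) (perms n)
      ≡ count (λ p → peaks p ≡ᵇ k) (dyckPaths n))
    × (count (λ p → peaks p ≡ᵇ k) (dyckPaths n)
      ≡ count (λ π → avoidsOneLine pat132 π ∧ (descents π ≡ᵇ (k ∸ 1))) (perms n))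
    × (count (λ π → avoidsOneLine pat132 π ∧ (descents π ≡ᵇ (k ∸ 1))) (perms n)
      ≡ narayana n k)
mainTheorem13 (suc m) (suc j) 1≤n _ _ =
    trans (count-cycAvoiders greedyPattern132 n k) (sym (count-cycAvoiders greedyPattern123 n k))
  , trans (count-cycAvoiders greedyPattern123 n k) (sym (count-dyckPaths n k))
  , trans (count-dyckPaths n k) (sym (count-132-avoiders-by-descents n j 1≤n))
  , trans (count-132-avoiders-by-descents n j 1≤n) (pathsFrom≡narayana m j)
  where
  n = suc m
  k = suc j
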